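{- For every integer $k\geq 3$ and every real $\mu\in (0,\frac{k-1}{k})$ there is a set of natural numbers $X=X(k,\mu)\subseteq \mathbb{N}$ such that (i) for every integer $r\geq 1$, every colouring of $X$ with $r$ colours contains a monochromatic arithmetic progression of length $k$, and (ii) every finite subset $Y\subseteq X$ contains a subset $Z\subseteq Y$ of size $|Z|\geq \mu|Y|$ that contains no arithmetic progression of length $k$.
   Context: An arithmetic progression of length $k$ is a set $\{a, a+d, a+2d,\dots, a+(k-1)d\}$ of $k$ integers with $d\neq 0$. -}

module Defs where

open import Data.Nat using (ℕ; zero; suc; _+_; _*_; _∸_; _≤_; _<_; _≥_)
open import Data.Bool using (Bool; T)
open import Data.Fin using (Fin)
open import Data.List using (List; length)
open import Data.List.Membership.Propositional using (_∈_)
open import Data.List.Relation.Unary.Unique.Propositional using (Unique)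
open import Data.Product using (Σ; ∃; _×_; _,_)
open import Relation.Binary.PropositionalEquality using (_≡_)
open import Relation.Nullary using (¬_)

NatSet : Set
NatSet = ℕ → Bool

_∈S_ : ℕ → NatSet → Set
n ∈S X = T (X n)

-- The k-term arithmetic progression {a, a+d, ..., a+(k-1)d} with d ≠ 0 is
-- contained in the predicate P.  Over ℕ we may take d > 0 w.l.o.g.
-- (a progression with negative difference is the same set read backwards).
APIn : (P : ℕ → Set) → (k a d : ℕ) → Set
APIn P k a d = (0 < d) × ((i : ℕ) → i < k → P (a + i * d))

Colouring : NatSet → ℕ → Set
Colouring X r = (n : ℕ) → n ∈S X → Fin r

HasMonoAP : (X : NatSet) (r : ℕ) → Colouring X r → ℕ → Set
HasMonoAP X r c k =
  Σ ℕ λ a → Σ ℕ λ d → Σ (Fin r) λ j →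
    (0 < d) ×
    ((i : ℕ) → i < k → Σ ((a + i * d) ∈S X) λ m → c (a + i * d) m ≡ j)

FinSubsetOf : NatSet → List ℕ → Set
FinSubsetOf X Y = Unique Y × ((n : ℕ) → n ∈ Y → n ∈S X)

_⊆L_ : List ℕ → List ℕ → Set
Z ⊆L Y = Unique Z × ((n : ℕ) → n ∈ Z → n ∈ Y)

APFree : ℕ → List ℕ → Set
APFree k Z = ¬ (Σ ℕ λ a → Σ ℕ λ d → APIn (λ n → n ∈ Z) k a d)

{-# OPTIONS --safe #-}

-- It suffices to build, for every r, a finite set that is Ramsey for r colours and has
-- property (ii): translates of these sets that are far enough apart have no progression
-- meeting two of them.
--
-- Such a set is obtained by amalgamation over the hypergraph of k consecutive windows of
-- decreasing sequences, whose chromatic number is unbounded. Each point of the set is labelled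
-- by a window so that every progression projects to an edge. Marking the numbers at random and
-- recording, modulo k, the position of the first marked entry of a window splits every edge
-- into all k residues unless that position is close to an end, which is unlikely; so discarding
-- a random residue class keeps about (k-1)/k of the points and destroys all progressions.
--
-- The fibres of the labelling are made monochromatic one at a time. The points over a vertex
-- are the alphabet of a Hales-Jewett cube, and every combinatorial line in the cube is completed
-- to a homothetic copy of the whole configuration. For k ≥ 4 no unwanted progressions arise,
-- since a progression is determined by two of its terms. For k = 3 they arise only from three
-- lines such that every coordinate is active in none or in exactly two of them, and the
-- Hales-Jewett theorem holds for a family of lines without such triples: run Shelah's argument
-- with consecutive pairs of a shift graph in place of single thresholds.
module Submission where

open import Defs
open import Data.Bool using (Bool; true; false; if_then_else_)
open import Data.Bool.Properties using (T?; T-irrelevant)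
open import Data.Empty using (⊥; ⊥-elim)
open import Data.Fin as Fin using (Fin; zero; suc; toℕ; fromℕ<; funToFin; finToFun; combine; remQuot; splitAt; join; punchOut)
open import Data.Fin.Properties using (toℕ<n; toℕ-fromℕ<; finToFun-funToFin; remQuot-combine; splitAt-join; pigeonhole; any?; ¬∀⟶∃¬; punchOut-injective)
open import Data.List using (List; []; _∷_; map; concatMap; allFin; cartesianProductWith; filter; deduplicate; lookup; length; take; drop; upTo; _++_)
open import Data.List.Membership.DecPropositional using (_∈?_)
open import Data.List.Membership.Propositional using (_∈_; find)
open import Data.List.Membership.Propositional.Properties
open import Data.List.Properties using (drop-drop; length-++; length-drop; length-take; ∷-injectiveˡ; ≡-dec)
open import Data.List.Relation.Unary.All as All using (All; []; _∷_)
open import Data.List.Relation.Unary.AllPairs using ([]; _∷_)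
open import Data.List.Relation.Unary.Any as Any using (here; there)
open import Data.List.Relation.Unary.Any.Properties using (lookup-index)
open import Data.List.Relation.Unary.Unique.DecPropositional.Properties using (deduplicate-!)
open import Data.List.Relation.Unary.Unique.Propositional using (Unique)
open import Data.List.Relation.Unary.Unique.Propositional.Properties as Unique using ()
open import Data.Maybe as Maybe using (Maybe; just; nothing; fromMaybe; maybe′)
open import Data.Maybe.Properties using (just-injective)
open import Data.Nat
open import Data.Nat.DivMod using ([m+kn]%n≡m%n; m<n⇒m%n≡m; m≡m%n+[m/n]*n; m%n<n; m%n≤m)
open import Data.Nat.ListAction using (sum)
open import Data.Nat.Properties
open import Data.Nat.Solver using (module +-*-Solver)
open import Data.Product using (Σ; ∃; _×_; _,_; proj₁; proj₂)
open import Data.Sum as Sum using (_⊎_; inj₁; inj₂; [_,_])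
open import Data.Unit using (⊤; tt)
open import Data.Vec using (Vec; []; _∷_)
open import Function using (_∘_; id; case_of_)
open import Relation.Binary.Definitions using (DecidableEquality; tri<; tri≈; tri>)
open import Relation.Binary.PropositionalEquality hiding ([_])
open import Relation.Nullary using (¬_; ¬?; Dec; yes; no; ⌊_⌋; _×-dec_)
open import Relation.Nullary.Decidable using (fromWitness; toWitness)
open import Relation.Unary using (Decidable)
open +-*-Solver using (solve; _:+_; _:*_; _:=_; con)

-- Monochromatic walks

funToFin-cong : ∀ {m n} {f g : Fin m → Fin n} → f ≗ g → funToFin f ≡ funToFin g
funToFin-cong {zero}  e = refl
funToFin-cong {suc m} e = cong₂ combine (e zero) (funToFin-cong (e ∘ suc))

funToFin-injective : ∀ {m n} (f g : Fin m → Fin n) → funToFin f ≡ funToFin g → f ≗ g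
funToFin-injective f g e i =
  trans (sym (finToFun-funToFin f i)) (trans (cong (λ x → finToFun x i) e) (finToFun-funToFin g i))

module Walks {A : Set} {N R : ℕ} (step : A → Fin N → A)
             (Ok : A → Fin N → Set) (ok? : ∀ a j → Dec (Ok a j)) (c : A → Fin N → Fin R) where

  Walk : Fin R → ℕ → A → Set
  Walk γ zero    a = ⊤
  Walk γ (suc t) a = ∃ λ j → Ok a j × c a j ≡ γ × Walk γ t (step a j)

  walk? : ∀ γ t a → Dec (Walk γ t a)
  walk? γ zero    a = yes tt
  walk? γ (suc t) a = any? λ j → ok? a j ×-dec (c a j Fin.≟ γ) ×-dec walk? γ t (step a j)

  private
    bit : ∀ {P : Set} → Dec P → Fin 2
    bit (yes _) = suc zero
    bit (no _)  = zero

    bit-transport : ∀ {P Q : Set} (p? : Dec P) (q? : Dec Q) → bit p? ≡ bit q? → P → Q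
    bit-transport _       (yes q) _  _ = q
    bit-transport (no ¬p) (no _)  _  p = ⊥-elim (¬p p)
    bit-transport (yes _) (no _)  () _

    table : ∀ K → A → Fin (R * suc K) → Fin 2
    table K a x = bit (walk? (proj₁ (remQuot (suc K) x)) (toℕ (proj₂ (remQuot {R} (suc K) x))) a)

  -- The pairs of a colour and a length at most `K` for which a monochromatic walk leaves `a`, coded
  -- as a number. The number of codes does not depend on the number of vertices, so in a large graph
  -- of shift type the code must repeat along some edge.
  walks : ∀ K → A → Fin (2 ^ (R * suc K))
  walks K a = funToFin (table K a)

  private
    table-combine : ∀ K a γ (t : Fin (suc K)) → table K a (combine γ t) ≡ bit (walk? γ (toℕ t) a)
    table-combine K a γ t = cong (λ x → bit (walk? (proj₁ x) (toℕ (proj₂ x)) a)) (remQuot-combine γ t)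

    walks-transport : ∀ K a b → walks K a ≡ walks K b → ∀ γ (t : Fin (suc K)) → Walk γ (toℕ t) a → Walk γ (toℕ t) b
    walks-transport K a b e γ t = bit-transport (walk? γ (toℕ t) a) (walk? γ (toℕ t) b)
      (trans (sym (table-combine K a γ t))
        (trans (funToFin-injective (table K a) (table K b) e (combine γ t)) (table-combine K b γ t)))

  -- Prepending the edge (a , j) to a walk from step a j gives a longer walk from a, which is
  -- again available at step a j.
  walk-of-repetition : ∀ K a j → Ok a j → walks K a ≡ walks K (step a j) →
                       ∀ t → t ≤ K → Walk (c a j) t a
  walk-of-repetition K a j ok e zero    t≤K = tt
  walk-of-repetition K a j ok e (suc t) t<K =
    j , ok , refl , subst (λ s → Walk (c a j) s (step a j)) (toℕ-fromℕ< t<1+K)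
      (walks-transport K a (step a j) e (c a j) (fromℕ< t<1+K)
        (subst (λ s → Walk (c a j) s a) (sym (toℕ-fromℕ< t<1+K))
          (walk-of-repetition K a j ok e t (<⇒≤ t<K))))
    where t<1+K = m≤n⇒m≤1+n t<K

-- The factor 3 in the exponent counts the walk lengths 0, 1 and 2.
shift-size : ℕ → ℕ
shift-size R = suc (2 ^ (R * 3))

-- Shift graphs have unbounded chromatic number: by pigeonhole some i < j have equal walk codes, and
-- the repetition yields a two-step monochromatic walk from i.
shift-pairs : ∀ R (c : Fin (shift-size R) → Fin (shift-size R) → Fin R) →
              ∃ λ i → ∃ λ j → ∃ λ l → toℕ i < toℕ j × toℕ j < toℕ l × c i j ≡ c j l
shift-pairs R c = path
  where
  open Walks (λ _ j → j) (λ i j → toℕ i < toℕ j) (λ i j → toℕ i <? toℕ j) c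
  path : ∃ λ i → ∃ λ j → ∃ λ l → toℕ i < toℕ j × toℕ j < toℕ l × c i j ≡ c j l
  path with pigeonhole (n<1+n _) (walks 2)
  ... | i , j , i<j , e with walk-of-repetition 2 i j i<j e 2 ≤-refl
  ...   | x , i<x , cx , y , x<y , cy , tt = i , x , y , i<x , x<y , trans cx (sym cy)

-- Hales-Jewett without clashing lines

Enumeration : Set → Set
Enumeration A = Σ (List A) λ xs → ∀ a → a ∈ xs

enum-⊤ : Enumeration ⊤
enum-⊤ = (tt ∷ []) , λ _ → here refl

enum-Fin : ∀ n → Enumeration (Fin n)
enum-Fin n = allFin n , ∈-allFin

enum-Σ : ∀ {A : Set} {B : A → Set} → Enumeration A → (∀ a → Enumeration (B a)) → Enumeration (Σ A B)
enum-Σ {A} {B} (xs , xs∋) ys = concatMap f xs , λ (a , b) →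
  ∈-concatMap⁺ f (Any.map (λ { refl → ∈-map⁺ (a ,_) (proj₂ (ys a) b) }) (xs∋ a))
  where f : A → List (Σ A B)
        f a = map (a ,_) (proj₁ (ys a))

-- Words are functions, so it must be demanded that colourings respect pointwise equality.
Extensional : {I A C : Set} → ((I → A) → C) → Set
Extensional c = ∀ f g → f ≗ g → c f ≡ c g

-- Three line templates whose every column has this shape are the obstruction to amalgamating
-- three-term progressions: nothing marks an active coordinate.
data Clash {A : Set} : Maybe A → Maybe A → Maybe A → Set where
  fixed  : ∀ a → Clash (just a) (just a) (just a)
  first  : ∀ a → Clash (just a) nothing nothing
  second : ∀ a → Clash nothing (just a) nothing
  third  : ∀ a → Clash nothing nothing (just a)

clash-swap₁₂ : ∀ {A : Set} {x y z : Maybe A} → Clash x y z → Clash y x z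
clash-swap₁₂ (fixed a)  = fixed a
clash-swap₁₂ (first a)  = second a
clash-swap₁₂ (second a) = first a
clash-swap₁₂ (third a)  = third a

clash-swap₂₃ : ∀ {A : Set} {x y z : Maybe A} → Clash x y z → Clash x z y
clash-swap₂₃ (fixed a)  = fixed a
clash-swap₂₃ (first a)  = first a
clash-swap₂₃ (second a) = third a
clash-swap₂₃ (third a)  = second a

fill-in : ∀ {I A : Set} → (I → Maybe A) → A → I → A
fill-in t a i = fromMaybe a (t i)

-- A finite family of combinatorial lines over an alphabet of `b` letters. Coordinates form an
-- arbitrary type, built later from sums; `coord` enumerates it, and a one-sided inverse is enough
-- to transfer statements about all coordinates.
record LineFamily (b : ℕ) : Set₁ where
  field
    Coord      : Set
    size       : ℕ
    index      : Coord → Fin size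
    coord      : Fin size → Coord
    coord-index : ∀ i → coord (index i) ≡ i
    Line       : Set
    lines      : Enumeration Line
    template   : Line → Coord → Maybe (Fin b)
    active     : ∀ l → ∃ λ i → template l i ≡ nothing
    clash-free : ∀ l₁ l₂ l₃ → ¬ (∀ i → Clash (template l₁ i) (template l₂ i) (template l₃ i))

  Ramsey : ℕ → Set
  Ramsey r = (c : (Coord → Fin b) → Fin r) → Extensional c →
    ∃ λ l → ∀ β β′ → c (fill-in (template l) β) ≡ c (fill-in (template l) β′)

open LineFamily

module _ {A : Set} where

  step : (low high : A) (lo hi : ℕ) (x : A) (p : ℕ) → A
  step low high lo hi x p with p ≤? lo | p ≤? hi
  ... | yes _ | _     = low
  ... | no  _ | yes _ = x
  ... | no  _ | no  _ = high

  module _ (low high : A) {lo hi : ℕ} (x : A) {p : ℕ} where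

    step-mid : lo < p → p ≤ hi → step low high lo hi x p ≡ x
    step-mid lo<p p≤hi with p ≤? lo | p ≤? hi
    ... | yes p≤lo | _ = ⊥-elim (<⇒≱ lo<p p≤lo)
    ... | no _ | yes _ = refl
    ... | no _ | no p≰hi = ⊥-elim (p≰hi p≤hi)

    step-cases : step low high lo hi x p ≡ low ⊎ (lo < p × p ≤ hi × step low high lo hi x p ≡ x) ⊎ step low high lo hi x p ≡ high
    step-cases with p ≤? lo | p ≤? hi
    ... | yes _ | _ = inj₁ refl
    ... | no p≰lo | yes p≤hi = inj₂ (inj₁ (≰⇒> p≰lo , p≤hi , refl))
    ... | no _ | no _ = inj₂ (inj₂ refl)

-- Naturality in the alphabet: with `g` filling a letter in for `nothing`, a threshold template
-- turns into a word on its line.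
step-map : ∀ {A B : Set} (g : A → B) low high lo hi x p →
           g (step low high lo hi x p) ≡ step (g low) (g high) lo hi (g x) p
step-map g low high lo hi x p with p ≤? lo | p ≤? hi
... | yes _ | _     = refl
... | no  _ | yes _ = refl
... | no  _ | no  _ = refl

-- A block has two tracks. Thresholds i < j < l put the variable on (i , j] in the first track
-- and on (j , l] in the second; filling in the letters high and low displays the consecutive
-- pairs (i , j) and (j , l) of the shift graph.
Block : ℕ → Set
Block N = Fin N ⊎ Fin N

-- The nested bounds build i < j < l into the type, so that enumerating the thresholds takes no
-- filtering.
Thresholds : ℕ → Set
Thresholds N = Σ (Fin N) λ l → Σ (Fin (toℕ l)) λ j → Fin (toℕ j)

module _ {N : ℕ} (θ : Thresholds N) where
  θ₁ θ₂ θ₃ : ℕ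
  θ₁ = toℕ (proj₂ (proj₂ θ))
  θ₂ = toℕ (proj₁ (proj₂ θ))
  θ₃ = toℕ (proj₁ θ)

  θ₁<θ₂ : θ₁ < θ₂
  θ₁<θ₂ = toℕ<n (proj₂ (proj₂ θ))

  θ₂<θ₃ : θ₂ < θ₃
  θ₂<θ₃ = toℕ<n (proj₁ (proj₂ θ))

  θ₃<N : θ₃ < N
  θ₃<N = toℕ<n (proj₁ θ)

  θ₂<N : θ₂ < N
  θ₂<N = <-trans θ₂<θ₃ θ₃<N

thresholds : ∀ {N} {i j l : Fin N} → toℕ i < toℕ j → toℕ j < toℕ l →
             Σ (Thresholds N) λ θ → θ₁ θ ≡ toℕ i × θ₂ θ ≡ toℕ j × θ₃ θ ≡ toℕ l
thresholds {N} {i} {j} {l} i<j j<l = (l , fromℕ< j<l , fromℕ< i<j′) , toℕ-fromℕ< i<j′ , toℕ-fromℕ< j<l , refl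
  where i<j′ : toℕ i < toℕ (fromℕ< j<l)
        i<j′ = subst (toℕ i <_) (sym (toℕ-fromℕ< j<l)) i<j

enum-Thresholds : ∀ N → Enumeration (Thresholds N)
enum-Thresholds N = enum-Σ (enum-Fin N) λ l → enum-Σ (enum-Fin (toℕ l)) λ j → enum-Fin (toℕ j)

block : ∀ {A : Set} {N} → A → A → Thresholds N → A → Block N → A
block low high θ x (inj₁ p) = step low high (θ₁ θ) (θ₂ θ) x (toℕ p)
block low high θ x (inj₂ p) = step low high (θ₂ θ) (θ₃ θ) x (toℕ p)

block-map : ∀ {A B : Set} {N} (g : A → B) low high (θ : Thresholds N) x q →
            g (block low high θ x q) ≡ block (g low) (g high) θ (g x) q
block-map g low high θ x (inj₁ p) = step-map g low high (θ₁ θ) (θ₂ θ) x (toℕ p)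
block-map g low high θ x (inj₂ p) = step-map g low high (θ₂ θ) (θ₃ θ) x (toℕ p)

Coords : ∀ {D} → Vec ℕ D → Set
Coords []       = ⊥
Coords (N ∷ Ns) = Block N ⊎ Coords Ns

AllThresholds : ∀ {D} → Vec ℕ D → Set
AllThresholds []       = ⊤
AllThresholds (N ∷ Ns) = Σ (Thresholds N) λ _ → AllThresholds Ns

enum-AllThresholds : ∀ {D} (Ns : Vec ℕ D) → Enumeration (AllThresholds Ns)
enum-AllThresholds []       = enum-⊤
enum-AllThresholds (N ∷ Ns) = enum-Σ (enum-Thresholds N) λ _ → enum-AllThresholds Ns

blocks : ∀ {A : Set} {D} {Ns : Vec ℕ D} → A → A → AllThresholds Ns → (Fin D → A) → Coords Ns → A
blocks {Ns = N ∷ Ns} low high (θ , θs) X (inj₁ q) = block low high θ (X zero) q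
blocks {Ns = N ∷ Ns} low high (θ , θs) X (inj₂ q) = blocks low high θs (X ∘ suc) q

blocks-map : ∀ {A B : Set} {D} {Ns : Vec ℕ D} (g : A → B) low high (θs : AllThresholds Ns) X q →
             g (blocks low high θs X q) ≡ blocks (g low) (g high) θs (g ∘ X) q
blocks-map {Ns = N ∷ Ns} g low high (θ , θs) X (inj₁ q) = block-map g low high θ (X zero) q
blocks-map {Ns = N ∷ Ns} g low high (θ , θs) X (inj₂ q) = blocks-map g low high θs (X ∘ suc) q

blocks-cong : ∀ {A : Set} {D} {Ns : Vec ℕ D} low high (θs : AllThresholds Ns) {X Y : Fin D → A} → X ≗ Y →
              blocks low high θs X ≗ blocks low high θs Y
blocks-cong {Ns = N ∷ Ns} low high (θ , θs) e (inj₁ q) = cong (λ x → block low high θ x q) (e zero)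
blocks-cong {Ns = N ∷ Ns} low high (θ , θs) e (inj₂ q) = blocks-cong low high θs (e ∘ suc) q

coords-size : ∀ {D} → Vec ℕ D → ℕ
coords-size []       = 0
coords-size (N ∷ Ns) = (N + N) + coords-size Ns

coords-index : ∀ {D} (Ns : Vec ℕ D) → Coords Ns → Fin (coords-size Ns)
coords-index (N ∷ Ns) q = join (N + N) (coords-size Ns) (Sum.map (join N N) (coords-index Ns) q)

coords-coord : ∀ {D} (Ns : Vec ℕ D) → Fin (coords-size Ns) → Coords Ns
coords-coord (N ∷ Ns) x = Sum.map (splitAt N) (coords-coord Ns) (splitAt (N + N) x)

coords-coord-index : ∀ {D} (Ns : Vec ℕ D) q → coords-coord Ns (coords-index Ns q) ≡ q
coords-coord-index (N ∷ Ns) (inj₁ q)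
  rewrite splitAt-join (N + N) (coords-size Ns) (inj₁ (join N N q)) = cong inj₁ (splitAt-join N N q)
coords-coord-index (N ∷ Ns) (inj₂ q)
  rewrite splitAt-join (N + N) (coords-size Ns) (inj₂ (coords-index Ns q)) = cong inj₂ (coords-coord-index Ns q)

-- Shelah's induction identifies the letters 0 and 1.
merge : ∀ {b} → Fin (2 + b) → Fin (1 + b)
merge zero          = zero
merge (suc zero)    = zero
merge (suc (suc x)) = suc x

unmerge : ∀ {b} → Fin (1 + b) → Fin (2 + b)
unmerge zero    = zero
unmerge (suc x) = suc (suc x)

merge-unmerge : ∀ {b} (x : Fin (1 + b)) → merge (unmerge x) ≡ x
merge-unmerge zero    = refl
merge-unmerge (suc x) = refl

module _ {b : ℕ} where

  0B 1B : Fin (2 + b)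
  0B = zero
  1B = suc zero

  words : ∀ {D} {Ns : Vec ℕ D} → AllThresholds Ns → (Fin D → Fin (2 + b)) → Coords Ns → Fin (2 + b)
  words = blocks 0B 1B

  -- With equal lower and upper threshold the middle letter never occurs, so each track makes a
  -- single jump from 0 to 1: at i in the first track and at j in the second.
  pair : ∀ {N} → Fin N → Fin N → Block N → Fin (2 + b)
  pair i j (inj₁ p) = step 0B 1B (toℕ i) (toℕ i) 0B (toℕ p)
  pair i j (inj₂ p) = step 0B 1B (toℕ j) (toℕ j) 0B (toℕ p)

  private
    step-1 : ∀ {i i′ j} p → i′ ≡ i → i′ ≤ j → step 0B 1B i i 0B p ≡ step 0B 1B i′ j 1B p
    step-1 {i} {.i} {j} p refl i≤j with p ≤? i | p ≤? j
    ... | yes _ | _ = refl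
    ... | no _ | yes _ = refl
    ... | no _ | no _ = refl

    step-0 : ∀ {i j j′} p → j′ ≡ j → i ≤ j′ → step 0B 1B j j 0B p ≡ step 0B 1B i j′ 0B p
    step-0 {i} {j} {.j} p refl i≤j with p ≤? i | p ≤? j
    ... | yes _ | yes _ = refl
    ... | yes p≤i | no p≰j = ⊥-elim (p≰j (≤-trans p≤i i≤j))
    ... | no _ | yes _ = refl
    ... | no _ | no _ = refl

  -- The letter 1 puts the jumps at the lower ends of the active intervals and the letter 0, in
  -- `pair-0`, at the upper ends. Equal colours on two consecutive pairs therefore make 0 and 1
  -- interchangeable.
  pair-1 : ∀ {N} {i j : Fin N} (θ : Thresholds N) → θ₁ θ ≡ toℕ i → θ₂ θ ≡ toℕ j → pair i j ≗ block 0B 1B θ 1B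
  pair-1 θ e₁ e₂ (inj₁ p) = step-1 (toℕ p) e₁ (<⇒≤ (θ₁<θ₂ θ))
  pair-1 θ e₁ e₂ (inj₂ p) = step-1 (toℕ p) e₂ (<⇒≤ (θ₂<θ₃ θ))

  pair-0 : ∀ {N} {j l : Fin N} (θ : Thresholds N) → θ₂ θ ≡ toℕ j → θ₃ θ ≡ toℕ l → pair j l ≗ block 0B 1B θ 0B
  pair-0 θ e₂ e₃ (inj₁ p) = step-0 (toℕ p) e₂ (<⇒≤ (θ₁<θ₂ θ))
  pair-0 θ e₂ e₃ (inj₂ p) = step-0 (toℕ p) e₃ (<⇒≤ (θ₂<θ₃ θ))

  Insensitive : ∀ {R D} (Ns : Vec ℕ D) → ((Coords Ns → Fin (2 + b)) → Fin R) → Set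
  Insensitive {R} {D} Ns c = ∃ λ θs → ∀ (w w′ : Fin D → Fin (2 + b)) → (∀ d → merge (w d) ≡ merge (w′ d)) →
                       c (words θs w) ≡ c (words θs w′)

  append : ∀ {A : Set} {N D} {Ns : Vec ℕ D} → (Block N → A) → (Coords Ns → A) → Coords (N ∷ Ns) → A
  append x y = [ x , y ]

  -- Shelah's induction on the number of blocks. The remaining blocks are made insensitive for every
  -- content of the first one simultaneously; then the shift graph supplies thresholds for the
  -- first.
  insensitive : ∀ R D → Σ (Vec ℕ D) λ Ns →
                ∀ (c : (Coords Ns → Fin (2 + b)) → Fin R) → Extensional c → Insensitive Ns c
  insensitive R zero    = [] , λ c ext → tt , λ w w′ _ → ext _ _ λ ()
  insensitive R (suc D) = N ∷ Ns , main
    where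
    -- A colour here records the values on all words in the D remaining letters. Their number does
    -- not involve the lengths `Ns`, so N can be fixed before these are known.
    R₀ = R ^ ((2 + b) ^ D)
    N  = shift-size R₀
    -- One value for every possible content of the first block.
    R₁ = R ^ ((2 + b) ^ (N + N))
    Ns = proj₁ (insensitive R₁ D)

    main : ∀ (c : (Coords (N ∷ Ns) → Fin (2 + b)) → Fin R) → Extensional c → Insensitive (N ∷ Ns) c
    main c ext = (θ , θs) , final
      where
      decode : Fin ((2 + b) ^ (N + N)) → Block N → Fin (2 + b)
      decode κ = finToFun κ ∘ join N N

      code : (Block N → Fin (2 + b)) → Fin ((2 + b) ^ (N + N))
      code x = funToFin (x ∘ splitAt N)

      decode-code : ∀ x → decode (code x) ≗ x
      decode-code x q = trans (finToFun-funToFin (x ∘ splitAt N) (join N N q)) (cong x (splitAt-join N N q))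

      append-cong : ∀ {x x′ : Block N → Fin (2 + b)} {y y′ : Coords Ns → Fin (2 + b)} → x ≗ x′ → y ≗ y′ →
                    c (append {Ns = Ns} x y) ≡ c (append {Ns = Ns} x′ y′)
      append-cong ex ey = ext _ _ λ { (inj₁ q) → ex q ; (inj₂ q) → ey q }

      c₁ : (Coords Ns → Fin (2 + b)) → Fin R₁
      c₁ y = funToFin (λ κ → c (append {Ns = Ns} (decode κ) y))

      rest : Insensitive Ns c₁
      rest = proj₂ (insensitive R₁ D) c₁ λ y y′ e →
        funToFin-cong {(2 + b) ^ (N + N)} {R} {λ κ → c (append {Ns = Ns} (decode κ) y)} {λ κ → c (append {Ns = Ns} (decode κ) y′)}
          λ κ → append-cong {x = decode κ} (λ _ → refl) e

      θs = proj₁ rest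

      rest-insensitive : ∀ x w w′ → (∀ d → merge (w d) ≡ merge (w′ d)) →
                         c (append {Ns = Ns} x (words θs w)) ≡ c (append {Ns = Ns} x (words θs w′))
      rest-insensitive x w w′ e =
        trans (append-cong (sym ∘ decode-code x) (λ _ → refl))
          (trans (funToFin-injective (λ κ → c (append {Ns = Ns} (decode κ) (words θs w))) _ (proj₂ rest w w′ e) (code x))
            (append-cong (decode-code x) (λ _ → refl)))

      c₀ : Fin N → Fin N → Fin R₀
      c₀ i j = funToFin λ κ → c (append {Ns = Ns} (pair i j) (words θs (finToFun κ)))

      shifted = shift-pairs R₀ c₀
      i = proj₁ shifted
      j = proj₁ (proj₂ shifted)
      l = proj₁ (proj₂ (proj₂ shifted))

      θ-spec : Σ (Thresholds N) λ θ → θ₁ θ ≡ toℕ i × θ₂ θ ≡ toℕ j × θ₃ θ ≡ toℕ l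
      θ-spec = thresholds (proj₁ (proj₂ (proj₂ (proj₂ shifted)))) (proj₁ (proj₂ (proj₂ (proj₂ (proj₂ shifted)))))

      θ = proj₁ θ-spec

      c₀-eq : c₀ i j ≡ c₀ j l
      c₀-eq = proj₂ (proj₂ (proj₂ (proj₂ (proj₂ shifted))))

      swap : ∀ w → c (append {Ns = Ns} (block 0B 1B θ 1B) (words θs w)) ≡ c (append {Ns = Ns} (block 0B 1B θ 0B) (words θs w))
      swap w =
        trans (append-cong (sym ∘ pair-1 θ (proj₁ (proj₂ θ-spec)) (proj₁ (proj₂ (proj₂ θ-spec)))) w-code)
          (trans (funToFin-injective (λ κ → c (append {Ns = Ns} (pair i j) (words θs (finToFun κ)))) _ c₀-eq (funToFin w))
            (append-cong (pair-0 θ (proj₁ (proj₂ (proj₂ θ-spec))) (proj₂ (proj₂ (proj₂ θ-spec)))) (sym ∘ w-code)))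
        where
        w-code : words θs w ≗ words θs (finToFun (funToFin w))
        w-code = blocks-cong 0B 1B θs (sym ∘ finToFun-funToFin w)

      head-insensitive : ∀ x x′ → merge x ≡ merge x′ → ∀ w →
        c (append {Ns = Ns} (block 0B 1B θ x) (words θs w)) ≡ c (append {Ns = Ns} (block 0B 1B θ x′) (words θs w))
      head-insensitive zero zero e w = refl
      head-insensitive zero (suc zero) e w = sym (swap w)
      head-insensitive (suc zero) zero e w = swap w
      head-insensitive (suc zero) (suc zero) e w = refl
      head-insensitive (suc (suc x)) (suc (suc .x)) refl w = refl

      split : ∀ w → words (θ , θs) w ≗ append {Ns = Ns} (block 0B 1B θ (w zero)) (words θs (w ∘ suc))
      split w (inj₁ q) = refl
      split w (inj₂ q) = refl

      final : ∀ w w′ → (∀ d → merge (w d) ≡ merge (w′ d)) → c (words (θ , θs) w) ≡ c (words (θ , θs) w′)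
      final w w′ e =
        trans (ext _ _ (split w))
          (trans (rest-insensitive _ (w ∘ suc) (w′ ∘ suc) (e ∘ suc))
            (trans (head-insensitive (w zero) (w′ zero) (e zero) (w′ ∘ suc)) (sym (ext _ _ (split w′)))))

  -- Clashes of expanded templates

  templates : ∀ {D} {Ns : Vec ℕ D} → AllThresholds Ns → (Fin D → Maybe (Fin (1 + b))) → Coords Ns → Maybe (Fin (2 + b))
  templates θs m = blocks (just 0B) (just 1B) θs (Maybe.map unmerge ∘ m)

  module _ {N : ℕ} where

    track : ℕ → ℕ → Maybe (Fin (1 + b)) → ℕ → Maybe (Fin (2 + b))
    track lo hi m p = step (just 0B) (just 1B) lo hi (Maybe.map unmerge m) p

    private
      inactive : ∀ lo hi x p → ∃ λ a → track lo hi (just x) p ≡ just a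
      inactive lo hi x p with step-cases (just 0B) (just 1B) {lo} {hi} (just (unmerge x)) {p}
      ... | inj₁ e = _ , e
      ... | inj₂ (inj₁ (_ , _ , e)) = _ , e
      ... | inj₂ (inj₂ e) = _ , e

      active⇒ : ∀ lo hi m p → track lo hi m p ≡ nothing → lo < p × p ≤ hi
      active⇒ lo hi m p e with step-cases (just 0B) (just 1B) {lo} {hi} (Maybe.map unmerge m) {p}
      ... | inj₁ e′ = case trans (sym e′) e of λ ()
      ... | inj₂ (inj₁ (lo<p , p≤hi , _)) = lo<p , p≤hi
      ... | inj₂ (inj₂ e′) = case trans (sym e′) e of λ ()

      unmerge-1 : ∀ (x : Fin (1 + b)) y → unmerge x ≡ suc (suc y) → x ≡ suc y
      unmerge-1 (suc x) .x refl = refl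

      -- Outside the middle interval only 0 and 1 occur, so a larger letter must come from x itself.
      letter : ∀ lo hi x p y → track lo hi (just x) p ≡ just (suc (suc y)) → x ≡ suc y
      letter lo hi x p y e with step-cases (just 0B) (just 1B) {lo} {hi} (just (unmerge x)) {p}
      ... | inj₁ e′ = case trans (sym e′) e of λ ()
      ... | inj₂ (inj₁ (_ , _ , e′)) = unmerge-1 x y (just-injective (trans (sym e′) e))
      ... | inj₂ (inj₂ e′) = case trans (sym e′) e of λ ()

      nothing-first : ∀ {A : Set} {x y z : Maybe A} → Clash x y z → x ≡ nothing → y ≡ nothing ⊎ z ≡ nothing
      nothing-first (second a) _ = inj₂ refl
      nothing-first (third a)  _ = inj₁ refl

      all-nothing : ∀ {A : Set} {x y z : Maybe A} → Clash x y z → x ≡ nothing → y ≡ nothing → z ≡ nothing → ⊥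
      all-nothing (second a) _ () _
      all-nothing (third a) _ _ ()

      one-nothing : ∀ {A : Set} {x y z : Maybe A} → Clash x y z → x ≡ nothing → (∃ λ a → y ≡ just a) → (∃ λ a → z ≡ just a) → ⊥
      one-nothing c x≡ (_ , y≡) (_ , z≡) with nothing-first c x≡
      ... | inj₁ e = case trans (sym e) y≡ of λ ()
      ... | inj₂ e = case trans (sym e) z≡ of λ ()

      same₁₂ : ∀ {A : Set} {x y z : Maybe A} → Clash x y z → (∃ λ a → x ≡ just a) → (∃ λ a → y ≡ just a) → x ≡ y
      same₁₂ (fixed a) _ _ = refl
      same₁₂ (first a) _ (_ , ())
      same₁₂ (second a) (_ , ()) _
      same₁₂ (third a) (_ , ()) _

    Clashing : (θ θ′ θ″ : Thresholds N) (m m′ m″ : Maybe (Fin (1 + b))) → Set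
    Clashing θ θ′ θ″ m m′ m″ = ∀ p → p < N →
      Clash (track (θ₁ θ) (θ₂ θ) m p) (track (θ₁ θ′) (θ₂ θ′) m′ p) (track (θ₁ θ″) (θ₂ θ″) m″ p) ×
      Clash (track (θ₂ θ) (θ₃ θ) m p) (track (θ₂ θ′) (θ₃ θ′) m′ p) (track (θ₂ θ″) (θ₃ θ″) m″ p)

    private
      clashing-swap₁₂ : ∀ {θ θ′ θ″ m m′ m″} → Clashing θ θ′ θ″ m m′ m″ → Clashing θ′ θ θ″ m′ m m″
      clashing-swap₁₂ h p p<N = clash-swap₁₂ (proj₁ (h p p<N)) , clash-swap₁₂ (proj₂ (h p p<N))

      clashing-swap₂₃ : ∀ {θ θ′ θ″ m m′ m″} → Clashing θ θ′ θ″ m m′ m″ → Clashing θ θ″ θ′ m m″ m′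
      clashing-swap₂₃ h p p<N = clash-swap₂₃ (proj₁ (h p p<N)) , clash-swap₂₃ (proj₂ (h p p<N))

      at-θ₂ : ∀ (θ : Thresholds N) → track (θ₁ θ) (θ₂ θ) nothing (θ₂ θ) ≡ nothing
      at-θ₂ θ = step-mid (just 0B) (just 1B) nothing (θ₁<θ₂ θ) ≤-refl

      after-θ₂ : ∀ (θ : Thresholds N) → track (θ₂ θ) (θ₃ θ) nothing (suc (θ₂ θ)) ≡ nothing
      after-θ₂ θ = step-mid (just 0B) (just 1B) nothing ≤-refl (θ₂<θ₃ θ)

      -- At the largest of the three middle thresholds a second template must be active in the
      -- first track, and just above the smallest one in the second track; so all three agree.
      sorted-active : ∀ {θ θ′ θ″} → θ₂ θ ≤ θ₂ θ′ → θ₂ θ′ ≤ θ₂ θ″ → ¬ Clashing θ θ′ θ″ nothing nothing nothing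
      sorted-active {θ} {θ′} {θ″} ≤₁ ≤₂ h =
        all-nothing (proj₁ (h (θ₂ θ) (θ₂<N θ))) (at-θ₂ θ)
          (trans (cong (track (θ₁ θ′) (θ₂ θ′) nothing) (sym 2≡1)) (at-θ₂ θ′))
          (trans (cong (track (θ₁ θ″) (θ₂ θ″) nothing) (trans (sym 2≡1) (sym 3≡2))) (at-θ₂ θ″))
        where
        3≤2 : θ₂ θ″ ≤ θ₂ θ′
        3≤2 with nothing-first (clash-swap₁₂ (clash-swap₂₃ (proj₁ (h (θ₂ θ″) (θ₂<N θ″))))) (at-θ₂ θ″)
        ... | inj₁ e = ≤-trans (proj₂ (active⇒ _ _ nothing _ e)) ≤₁
        ... | inj₂ e = proj₂ (active⇒ _ _ nothing _ e)
        2≤1 : θ₂ θ′ ≤ θ₂ θ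
        2≤1 with nothing-first (proj₂ (h (suc (θ₂ θ)) (≤-<-trans (θ₂<θ₃ θ) (θ₃<N θ)))) (after-θ₂ θ)
        ... | inj₁ e = ≤-pred (proj₁ (active⇒ _ _ nothing _ e))
        ... | inj₂ e = ≤-trans ≤₂ (≤-pred (proj₁ (active⇒ _ _ nothing _ e)))
        3≡2 = ≤-antisym 3≤2 ≤₂
        2≡1 = ≤-antisym 2≤1 ≤₁

      not-all-active : ∀ {θ θ′ θ″} → ¬ Clashing θ θ′ θ″ nothing nothing nothing
      not-all-active {θ} {θ′} {θ″} h with ≤-total (θ₂ θ) (θ₂ θ′) | ≤-total (θ₂ θ′) (θ₂ θ″) | ≤-total (θ₂ θ) (θ₂ θ″)
      ... | inj₁ a | inj₁ b | _      = sorted-active {θ} {θ′} {θ″} a b h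
      ... | inj₁ a | inj₂ b | inj₁ c = sorted-active {θ} {θ″} {θ′} c b (clashing-swap₂₃ {θ} {θ′} {θ″} {nothing} {nothing} {nothing} h)
      ... | inj₁ a | inj₂ b | inj₂ c = sorted-active {θ″} {θ} {θ′} c a
              (clashing-swap₁₂ {θ} {θ″} {θ′} {nothing} {nothing} {nothing} (clashing-swap₂₃ {θ} {θ′} {θ″} {nothing} {nothing} {nothing} h))
      ... | inj₂ a | inj₁ b | inj₁ c = sorted-active {θ′} {θ} {θ″} a c (clashing-swap₁₂ {θ} {θ′} {θ″} {nothing} {nothing} {nothing} h)
      ... | inj₂ a | inj₁ b | inj₂ c = sorted-active {θ′} {θ″} {θ} b c
              (clashing-swap₂₃ {θ′} {θ} {θ″} {nothing} {nothing} {nothing} (clashing-swap₁₂ {θ} {θ′} {θ″} {nothing} {nothing} {nothing} h))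
      ... | inj₂ a | inj₂ b | _      = sorted-active {θ″} {θ′} {θ} b a
              (clashing-swap₁₂ {θ′} {θ″} {θ} {nothing} {nothing} {nothing}
                (clashing-swap₂₃ {θ′} {θ} {θ″} {nothing} {nothing} {nothing} (clashing-swap₁₂ {θ} {θ′} {θ″} {nothing} {nothing} {nothing} h)))

      -- At `θ₂` the first template is active and the other two are fixed, but no clashing column
      -- has exactly one active entry.
      not-one-active : ∀ {θ θ′ θ″ x y} → ¬ Clashing θ θ′ θ″ nothing (just x) (just y)
      not-one-active {θ} {θ′} {θ″} {x} {y} h =
        one-nothing (proj₁ (h (θ₂ θ) (θ₂<N θ))) (at-θ₂ θ) (inactive _ _ x _) (inactive _ _ y _)

      -- A nonzero letter unmerges to one above 1, which is visible at the middle threshold and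
      -- forces the same letter in the other block. If neither is visible, both are 0.
      same-letter : ∀ (θ θ′ : Thresholds N) x y →
        (∀ p → p < N → track (θ₁ θ) (θ₂ θ) (just x) p ≡ track (θ₁ θ′) (θ₂ θ′) (just y) p) → x ≡ y
      same-letter θ θ′ zero zero h = refl
      same-letter θ θ′ (suc x) y h = sym (letter (θ₁ θ′) (θ₂ θ′) y (θ₂ θ) x
        (trans (sym (h _ (θ₂<N θ))) (step-mid (just 0B) (just 1B) (just (suc (suc x))) (θ₁<θ₂ θ) ≤-refl)))
      same-letter θ θ′ zero (suc y) h = letter (θ₁ θ) (θ₂ θ) zero (θ₂ θ′) y
        (trans (h _ (θ₂<N θ′)) (step-mid (just 0B) (just 1B) (just (suc (suc y))) (θ₁<θ₂ θ′) ≤-refl))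

      letters₁₂ : ∀ {θ θ′ θ″ x y m} → Clashing θ θ′ θ″ (just x) (just y) m → x ≡ y
      letters₁₂ {θ} {θ′} {θ″} {x} {y} h = same-letter θ θ′ x y
        λ p p<N → same₁₂ (proj₁ (h p p<N)) (inactive _ _ x _) (inactive _ _ y _)

    -- One or three active entries are excluded by the lemmas above, two are a clash already, and
    -- with none active the letters coincide.
    block-clash : ∀ {θ θ′ θ″ m m′ m″} → Clashing θ θ′ θ″ m m′ m″ → Clash m m′ m″
    block-clash {θ} {θ′} {θ″} {nothing} {nothing} {nothing} h = ⊥-elim (not-all-active {θ} {θ′} {θ″} h)
    block-clash {θ} {θ′} {θ″} {nothing} {nothing} {just z} h = third z
    block-clash {θ} {θ′} {θ″} {nothing} {just y} {nothing} h = second y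
    block-clash {θ} {θ′} {θ″} {just x} {nothing} {nothing} h = first x
    block-clash {θ} {θ′} {θ″} {nothing} {just y} {just z} h = ⊥-elim (not-one-active {θ} {θ′} {θ″} {y} {z} h)
    block-clash {θ} {θ′} {θ″} {just x} {nothing} {just z} h =
      ⊥-elim (not-one-active {θ′} {θ} {θ″} {x} {z} (clashing-swap₁₂ {θ} {θ′} {θ″} {just x} {nothing} {just z} h))
    block-clash {θ} {θ′} {θ″} {just x} {just y} {nothing} h =
      ⊥-elim (not-one-active {θ″} {θ} {θ′} {x} {y} (clashing-swap₁₂ {θ} {θ″} {θ′} {just x} {nothing} {just y}
        (clashing-swap₂₃ {θ} {θ′} {θ″} {just x} {just y} {nothing} h)))
    block-clash {θ} {θ′} {θ″} {just x} {just y} {just z} h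
      with letters₁₂ {θ} {θ′} {θ″} {x} {y} {just z} h
         | letters₁₂ {θ} {θ″} {θ′} {x} {z} {just y} (clashing-swap₂₃ {θ} {θ′} {θ″} {just x} {just y} {just z} h)
    ... | refl | refl = fixed x

  blocks-clash : ∀ {D} {Ns : Vec ℕ D} (θs θs′ θs″ : AllThresholds Ns) m m′ m″ →
    (∀ q → Clash (templates θs m q) (templates θs′ m′ q) (templates θs″ m″ q)) → ∀ d → Clash (m d) (m′ d) (m″ d)
  blocks-clash {Ns = N ∷ Ns} (θ , θs) (θ′ , θs′) (θ″ , θs″) m m′ m″ h zero =
    block-clash {θ = θ} {θ′} {θ″} λ p p<N →
      subst (λ p → Clash (track {N} (θ₁ θ) (θ₂ θ) (m zero) p) (track {N} (θ₁ θ′) (θ₂ θ′) (m′ zero) p) (track {N} (θ₁ θ″) (θ₂ θ″) (m″ zero) p))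
        (toℕ-fromℕ< p<N) (h (inj₁ (inj₁ (fromℕ< p<N)))) ,
      subst (λ p → Clash (track {N} (θ₂ θ) (θ₃ θ) (m zero) p) (track {N} (θ₂ θ′) (θ₃ θ′) (m′ zero) p) (track {N} (θ₂ θ″) (θ₃ θ″) (m″ zero) p))
        (toℕ-fromℕ< p<N) (h (inj₁ (inj₂ (fromℕ< p<N))))
  blocks-clash {Ns = N ∷ Ns} (θ , θs) (θ′ , θs′) (θ″ , θs″) m m′ m″ h (suc d) =
    blocks-clash θs θs′ θs″ (m ∘ suc) (m′ ∘ suc) (m″ ∘ suc) (h ∘ inj₂) d

  blocks-active : ∀ {D} {Ns : Vec ℕ D} (θs : AllThresholds Ns) m d → m d ≡ nothing → ∃ λ q → templates θs m q ≡ nothing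
  blocks-active {Ns = N ∷ Ns} (θ , θs) m zero e = inj₁ (inj₁ (fromℕ< (θ₂<N θ))) ,
    trans (cong (λ x → step (just 0B) (just 1B) (θ₁ θ) (θ₂ θ) (Maybe.map unmerge x) (toℕ (fromℕ< (θ₂<N θ)))) e)
      (step-mid (just 0B) (just 1B) nothing (subst (θ₁ θ <_) (sym (toℕ-fromℕ< (θ₂<N θ))) (θ₁<θ₂ θ)) (≤-reflexive (toℕ-fromℕ< (θ₂<N θ))))
  blocks-active {Ns = N ∷ Ns} (θ , θs) m (suc d) e with blocks-active θs (m ∘ suc) d e
  ... | q , e′ = inj₂ q , e′

  module _ (F : LineFamily (1 + b)) {r : ℕ} (F-ramsey : Ramsey F r) where

    private
      D = size F
      Ns = proj₁ (insensitive r D)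

    -- Every coordinate of `F` becomes a block. Clashing of three expanded lines in all columns
    -- descends block by block to the lines of `F`, so clash-freeness is inherited.
    expand : LineFamily (2 + b)
    expand = record
      { Coord       = Coords Ns
      ; size        = coords-size Ns
      ; index       = coords-index Ns
      ; coord       = coords-coord Ns
      ; coord-index = coords-coord-index Ns
      ; Line        = Σ (Line F) λ _ → AllThresholds Ns
      ; lines       = enum-Σ (lines F) λ _ → enum-AllThresholds Ns
      ; template    = λ (l , θs) → templates θs (template F l ∘ coord F)
      ; active      = λ (l , θs) → blocks-active θs (template F l ∘ coord F) (index F (proj₁ (active F l)))
                        (trans (cong (template F l) (coord-index F _)) (proj₂ (active F l)))
      ; clash-free  = λ (l , θs) (l′ , θs′) (l″ , θs″) h → clash-free F l l′ l″ λ i →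
          subst (λ i → Clash (template F l i) (template F l′ i) (template F l″ i)) (coord-index F i)
            (blocks-clash θs θs′ θs″ (template F l ∘ coord F) (template F l′ ∘ coord F) (template F l″ ∘ coord F) h (index F i))
      }

    -- Words over the smaller alphabet are coloured through `unmerge`. A monochromatic line for this
    -- colouring lifts, since insensitivity permits replacing each letter by the unmerged form of
    -- its merged value.
    expand-ramsey : Ramsey expand r
    expand-ramsey c ext with proj₂ (insensitive r D) c ext
    ... | θs , c-insensitive with F-ramsey (λ w → c (words θs (unmerge ∘ w ∘ coord F)))
                                   (λ w w′ e → ext _ _ (blocks-cong 0B 1B θs (cong unmerge ∘ e ∘ coord F)))
    ... | l , mono = (l , θs) , λ β β′ → trans (reduce β) (trans (mono (merge β) (merge β′)) (sym (reduce β′)))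
      where
      t = template F l

      merge-fill : ∀ β m → merge (fromMaybe β (Maybe.map unmerge m)) ≡ merge (unmerge (fromMaybe (merge β) m))
      merge-fill β nothing  = sym (merge-unmerge (merge β))
      merge-fill β (just x) = refl

      reduce : ∀ β → c (fill-in (templates θs (t ∘ coord F)) β) ≡ c (words θs (unmerge ∘ fill-in t (merge β) ∘ coord F))
      reduce β = trans (ext _ _ λ q → blocks-map (fromMaybe β) (just 0B) (just 1B) θs _ q)
        (c-insensitive _ _ λ d → merge-fill β (t (coord F d)))

-- Its only column is active in all three templates, which is not a clash.
single : ∀ b → LineFamily b
single b = record
  { Coord       = ⊤
  ; size        = 1
  ; index       = λ _ → zero
  ; coord       = λ _ → tt
  ; coord-index = λ _ → refl
  ; Line        = ⊤
  ; lines       = enum-⊤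
  ; template    = λ _ _ → nothing
  ; active      = λ _ → tt , refl
  ; clash-free  = λ _ _ _ h → case h tt of λ ()
  }

-- With at most one letter there is nothing to compare along a line; each further letter is added by
-- one expansion.
hales-jewett : ∀ b r → Σ (LineFamily b) λ F → Ramsey F r
hales-jewett zero          r = single 0 , λ c ext → tt , λ ()
hales-jewett (suc zero)    r = single 1 , λ { c ext → tt , λ { zero zero → refl } }
hales-jewett (suc (suc b)) r with hales-jewett (suc b) r
... | F , F-ramsey = expand F F-ramsey , expand-ramsey F F-ramsey

-- Progressions and digits

-- Stated without subtraction, so decreasing progressions are included.
IsAP : ℕ → (ℕ → ℕ) → Set
IsAP k x = ∀ j → 2 + j < k → x j + x (2 + j) ≡ x (1 + j) + x (1 + j)

module _ {k : ℕ} (x : ℕ → ℕ) (ap : IsAP k x) where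

  ap-difference : ∀ j → suc j < k → x j + x 1 ≡ x (suc j) + x 0
  ap-difference zero    _ = +-comm (x 0) (x 1)
  ap-difference (suc j) h = +-cancelˡ-≡ (x j) _ _ (begin
    x j + (x (1 + j) + x 1)         ≡⟨ solve 3 (λ a b c → a :+ (b :+ c) := b :+ (a :+ c)) refl (x j) (x (1 + j)) (x 1) ⟩
    x (1 + j) + (x j + x 1)         ≡⟨ cong (x (1 + j) +_) (ap-difference j (<⇒≤ h)) ⟩
    x (1 + j) + (x (1 + j) + x 0)   ≡⟨ +-assoc (x (1 + j)) (x (1 + j)) (x 0) ⟨
    x (1 + j) + x (1 + j) + x 0     ≡⟨ cong (_+ x 0) (ap j h) ⟨
    x j + x (2 + j) + x 0           ≡⟨ +-assoc (x j) (x (2 + j)) (x 0) ⟩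
    x j + (x (2 + j) + x 0)         ∎)
    where open ≡-Reasoning

  ap-linear : ∀ j → j < k → x j + j * x 0 ≡ x 0 + j * x 1
  ap-linear zero    _ = refl
  ap-linear (suc j) h = begin
    x (suc j) + (x 0 + j * x 0)  ≡⟨ +-assoc (x (suc j)) (x 0) (j * x 0) ⟨
    x (suc j) + x 0 + j * x 0    ≡⟨ cong (_+ j * x 0) (ap-difference j h) ⟨
    x j + x 1 + j * x 0          ≡⟨ solve 3 (λ a b c → a :+ b :+ c := a :+ c :+ b) refl (x j) (x 1) (j * x 0) ⟩
    x j + j * x 0 + x 1          ≡⟨ cong (_+ x 1) (ap-linear j (<⇒≤ h)) ⟩
    x 0 + j * x 1 + x 1          ≡⟨ solve 3 (λ a b c → a :+ b :+ c := a :+ (c :+ b)) refl (x 0) (j * x 1) (x 1) ⟩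
    x 0 + (x 1 + j * x 1)        ∎
    where open ≡-Reasoning

  ap-constant : x 0 ≡ x 1 → ∀ j → j < k → x j ≡ x 0
  ap-constant e j h = +-cancelʳ-≡ (j * x 0) (x j) (x 0)
    (trans (ap-linear j h) (cong (λ z → x 0 + j * z) (sym e)))

private
  -- The equations are the subtraction-free form of a = u + j (v - u) at the positions j and j + e +
  -- 1. Eliminating `a` and `a′` by `cross` and comparing the results gives equal slopes, then equal
  -- starting values.
  line-determined : ∀ j e u v u′ v′ a a′ →
    a + j * u ≡ u + j * v → a + j * u′ ≡ u′ + j * v′ →
    a′ + (j + suc e) * u ≡ u + (j + suc e) * v → a′ + (j + suc e) * u′ ≡ u′ + (j + suc e) * v′ →
    u ≡ u′ × v ≡ v′
  line-determined j e u v u′ v′ a a′ p p′ q q′ = u≡u′ , v≡v′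
    where
    open ≡-Reasoning
    cross : ∀ i b → b + i * u ≡ u + i * v → b + i * u′ ≡ u′ + i * v′ → u + i * (v + u′) ≡ u′ + i * (v′ + u)
    cross i b p p′ = begin
      u + i * (v + u′)          ≡⟨ solve 4 (λ u i v u′ → u :+ i :* (v :+ u′) := u :+ i :* v :+ i :* u′) refl u i v u′ ⟩
      u + i * v + i * u′        ≡⟨ cong (_+ i * u′) p ⟨
      b + i * u + i * u′        ≡⟨ solve 3 (λ b x y → b :+ x :+ y := b :+ y :+ x) refl b (i * u) (i * u′) ⟩
      b + i * u′ + i * u        ≡⟨ cong (_+ i * u) p′ ⟩
      u′ + i * v′ + i * u       ≡⟨ solve 4 (λ u i v u′ → u′ :+ i :* (v :+ u) := u′ :+ i :* v :+ i :* u) refl u i v′ u′ ⟨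
      u′ + i * (v′ + u)         ∎
    split : ∀ x y → x + (j + suc e) * y ≡ x + j * y + suc e * y
    split x y = solve 4 (λ x j e y → x :+ (j :+ e) :* y := x :+ j :* y :+ e :* y) refl x j (suc e) y
    slope : v + u′ ≡ v′ + u
    slope = *-cancelˡ-≡ (v + u′) (v′ + u) (suc e) (+-cancelˡ-≡ (u + j * (v + u′)) _ _ (begin
      u + j * (v + u′) + suc e * (v + u′)    ≡⟨ split u (v + u′) ⟨
      u + (j + suc e) * (v + u′)             ≡⟨ cross (j + suc e) a′ q q′ ⟩
      u′ + (j + suc e) * (v′ + u)            ≡⟨ split u′ (v′ + u) ⟩
      u′ + j * (v′ + u) + suc e * (v′ + u)   ≡⟨ cong (_+ suc e * (v′ + u)) (cross j a p p′) ⟨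
      u + j * (v + u′) + suc e * (v′ + u)    ∎))
    u≡u′ : u ≡ u′
    u≡u′ = +-cancelʳ-≡ (j * (v + u′)) u u′ (trans (cross j a p p′) (cong (λ z → u′ + j * z) (sym slope)))
    v≡v′ : v ≡ v′
    v≡v′ = +-cancelʳ-≡ u′ v v′ (trans slope (cong (v′ +_) u≡u′))

module _ {k : ℕ} where

  private
    ap-determined-< : ∀ x y → IsAP k x → IsAP k y → ∀ {i j} → i < j → j < k →
                      x i ≡ y i → x j ≡ y j → ∀ l → l < k → x l ≡ y l
    ap-determined-< x y apx apy {i} i<j j<k ei ej l l<k with m≤n⇒∃[o]m+o≡n i<j
    ... | e , refl with line-determined i e (x 0) (x 1) (y 0) (y 1) (x i) (x (suc i + e))
          (ap-linear x apx i (<-trans i<j j<k))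
          (subst (λ z → z + i * y 0 ≡ y 0 + i * y 1) (sym ei) (ap-linear y apy i (<-trans i<j j<k)))
          (subst (λ n → x (suc i + e) + n * x 0 ≡ x 0 + n * x 1) (sym (+-suc i e)) (ap-linear x apx (suc i + e) j<k))
          (subst (λ n → x (suc i + e) + n * y 0 ≡ y 0 + n * y 1) (sym (+-suc i e))
            (subst (λ z → z + (suc i + e) * y 0 ≡ y 0 + (suc i + e) * y 1) (sym ej) (ap-linear y apy (suc i + e) j<k)))
    ... | e₀ , e₁ = +-cancelʳ-≡ (l * x 0) (x l) (y l) (begin
      x l + l * x 0  ≡⟨ ap-linear x apx l l<k ⟩
      x 0 + l * x 1  ≡⟨ cong₂ (λ a b → a + l * b) e₀ e₁ ⟩
      y 0 + l * y 1  ≡⟨ ap-linear y apy l l<k ⟨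
      y l + l * y 0  ≡⟨ cong (λ a → y l + l * a) e₀ ⟨
      y l + l * x 0  ∎)
      where open ≡-Reasoning

  ap-determined : ∀ x y → IsAP k x → IsAP k y → ∀ {i j} → i < k → j < k → i ≢ j →
                  x i ≡ y i → x j ≡ y j → ∀ l → l < k → x l ≡ y l
  ap-determined x y apx apy {i} {j} i<k j<k i≢j ei ej with <-cmp i j
  ... | tri< i<j _ _ = ap-determined-< x y apx apy i<j j<k ei ej
  ... | tri≈ _ i≡j _ = ⊥-elim (i≢j i≡j)
  ... | tri> _ _ j<i = ap-determined-< x y apx apy j<i i<k ej ei

  -- A progression with two equal terms agrees with a constant one in two places, hence everywhere.
  ap-injective : 1 < k → ∀ x → IsAP k x → x 0 ≢ x 1 → ∀ {i j} → i < k → j < k → x i ≡ x j → i ≡ j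
  ap-injective 1<k x ap x0≢x1 {i} {j} i<k j<k e with i ≟ j
  ... | yes i≡j = i≡j
  ... | no  i≢j = ⊥-elim (x0≢x1 (trans (const 0 (<⇒≤ 1<k)) (sym (const 1 1<k))))
    where const = ap-determined x (λ _ → x i) ap (λ _ _ → refl) i<k j<k i≢j refl (sym e)

module Digits (M : ℕ) .{{_ : NonZero M}} where

  encode : ∀ {n} → (Fin n → ℕ) → ℕ
  encode {zero}  f = 0
  encode {suc n} f = f zero + encode (f ∘ suc) * M

  encode-cong : ∀ {n} {f g : Fin n → ℕ} → f ≗ g → encode f ≡ encode g
  encode-cong {zero}  e = refl
  encode-cong {suc n} e = cong₂ (λ a b → a + b * M) (e zero) (encode-cong (e ∘ suc))

  encode-+ : ∀ {n} (f g : Fin n → ℕ) → encode (λ i → f i + g i) ≡ encode f + encode g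
  encode-+ {zero}  f g = refl
  encode-+ {suc n} f g = trans (cong (λ z → f zero + g zero + z * M) (encode-+ (f ∘ suc) (g ∘ suc)))
    (solve 5 (λ a b c d m → a :+ b :+ (c :+ d) :* m := a :+ c :* m :+ (b :+ d :* m)) refl
      (f zero) (g zero) (encode (f ∘ suc)) (encode (g ∘ suc)) M)

  encode-* : ∀ {n} (f : Fin n → ℕ) a → encode (λ i → f i * a) ≡ encode f * a
  encode-* {zero}  f a = refl
  encode-* {suc n} f a = trans (cong (λ z → f zero * a + z * M) (encode-* (f ∘ suc) a))
    (solve 4 (λ x c a m → x :* a :+ c :* a :* m := (x :+ c :* m) :* a) refl (f zero) (encode (f ∘ suc)) a M)

  encode-positive : ∀ {n} (f : Fin n → ℕ) i → 0 < f i → 0 < encode f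
  encode-positive f zero    h = ≤-trans h (m≤m+n (f zero) _)
  encode-positive f (suc i) h = ≤-trans (*-mono-≤ (encode-positive (f ∘ suc) i h) (>-nonZero⁻¹ M)) (m≤n+m _ (f zero))

  encode-injective : ∀ {n} (f g : Fin n → ℕ) → (∀ i → f i < M) → (∀ i → g i < M) → encode f ≡ encode g → f ≗ g
  encode-injective {suc n} f g f< g< e = λ { zero → head ; (suc i) → encode-injective (f ∘ suc) (g ∘ suc) (f< ∘ suc) (g< ∘ suc) tail i }
    where
    residue : ∀ (f : Fin (suc n) → ℕ) → (∀ i → f i < M) → encode f % M ≡ f zero
    residue f f< = trans ([m+kn]%n≡m%n (f zero) (encode (f ∘ suc)) M) (m<n⇒m%n≡m (f< zero))
    head : f zero ≡ g zero
    head = trans (sym (residue f f<)) (trans (cong (_% M) e) (residue g g<))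
    tail : encode (f ∘ suc) ≡ encode (g ∘ suc)
    tail = *-cancelʳ-≡ _ _ M (+-cancelˡ-≡ (f zero) _ _ (trans e (cong (_+ _) (sym head))))

unique-lookup : ∀ {A : Set} {xs : List A} → Unique xs → ∀ i j → lookup xs i ≡ lookup xs j → i ≡ j
unique-lookup (x∉ ∷ u) zero    zero    e = refl
unique-lookup (x∉ ∷ u) zero    (suc j) e = ⊥-elim (All.lookup x∉ (∈-lookup j) e)
unique-lookup (x∉ ∷ u) (suc i) zero    e = ⊥-elim (All.lookup x∉ (∈-lookup i) (sym e))
unique-lookup (x∉ ∷ u) (suc i) (suc j) e = cong suc (unique-lookup u i j e)

∈⇒≤sum : ∀ {n ns} → n ∈ ns → n ≤ sum ns
∈⇒≤sum (here refl)       = m≤m+n _ _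
∈⇒≤sum (there {x = m} p) = ≤-trans (∈⇒≤sum p) (m≤n+m _ m)

-- Amalgamation

-- The default `a` covers an empty fibre.
constant-value : ∀ {n} {A : Set} → A → (f : Fin n → A) → (∀ i j → f i ≡ f j) → ∃ λ κ → ∀ i → f i ≡ κ
constant-value {zero}  a f h = a , λ ()
constant-value {suc n} a f h = f zero , λ i → h i zero

module _ {k : ℕ} (3≤k : 3 ≤ k) {A : Set} (pos : A → ℕ) {T o w : ℕ} (far : w + (T + T) < o)
         {xs ys : List A} (low : ∀ {a} → a ∈ xs → pos a ≤ T)
         (high : ∀ {a} → a ∈ ys → o ≤ pos a × pos a ≤ o + w) where

  private
    2T<o : T + T < o
    2T<o = ≤-<-trans (m≤n+m (T + T) w) far

    w+T<o : w + T < o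
    w+T<o = ≤-<-trans (+-monoʳ-≤ w (m≤m+n T T)) far

    crossing : o + w + T < o + o
    crossing = subst (_< o + o) (sym (+-assoc o w T)) (+-monoʳ-< o w+T<o)

  low≢high : ∀ {a b} → a ∈ xs → b ∈ ys → pos a ≢ pos b
  low≢high a∈ b∈ e = <⇒≱ (≤-<-trans (≤-trans (low a∈) (m≤m+n T T)) 2T<o) (≤-trans (proj₁ (high b∈)) (≤-reflexive (sym e)))

  -- Each term is twice its predecessor minus the one before. Two low terms are followed by one at
  -- most 2T < o, two high terms by one at least o - w > T. Starting low then high would give a
  -- third term above o + w; starting high then low would give a negative one.
  split-progression : ∀ (f : ℕ → A) → (∀ {j} → j < k → f j ∈ xs ++ ys) → IsAP k (pos ∘ f) →
                      (∀ {j} → j < k → f j ∈ xs) ⊎ (∀ {j} → j < k → f j ∈ ys)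
  split-progression f f∈ ap with ∈-++⁻ xs (f∈ 0<k) | ∈-++⁻ xs (f∈ 1<k)
    where
    0<k = ≤-trans (s≤s z≤n) 3≤k
    1<k = ≤-trans (s≤s (s≤s z≤n)) 3≤k
  ... | inj₁ m₀ | inj₁ m₁ = inj₁ λ {j} → all-low j
    where
    all-low : ∀ j → j < k → f j ∈ xs
    all-low 0 _ = m₀
    all-low 1 _ = m₁
    all-low (suc (suc j)) h with all-low (suc j) (<-trans (n<1+n _) h) | ∈-++⁻ xs (f∈ h)
    ... | _  | inj₁ m = m
    ... | m′ | inj₂ m = ⊥-elim (<⇒≱ 2T<o (begin
      o                                       ≤⟨ proj₁ (high m) ⟩
      pos (f (2 + j))                         ≤⟨ m≤n+m _ _ ⟩
      pos (f j) + pos (f (2 + j))             ≡⟨ ap j h ⟩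
      pos (f (1 + j)) + pos (f (1 + j))       ≤⟨ +-mono-≤ (low m′) (low m′) ⟩
      T + T                                   ∎))
      where open ≤-Reasoning
  ... | inj₂ m₀ | inj₂ m₁ = inj₂ λ {j} → all-high j
    where
    all-high : ∀ j → j < k → f j ∈ ys
    all-high 0 _ = m₀
    all-high 1 _ = m₁
    all-high (suc (suc j)) h with all-high j (<-trans (n<1+n _) (<-trans (n<1+n _) h)) | all-high (suc j) (<-trans (n<1+n _) h) | ∈-++⁻ xs (f∈ h)
    ... | _  | _  | inj₂ m = m
    ... | m″ | m′ | inj₁ m = ⊥-elim (<⇒≱ crossing (begin
      o + o                                   ≤⟨ +-mono-≤ (proj₁ (high m′)) (proj₁ (high m′)) ⟩
      pos (f (1 + j)) + pos (f (1 + j))       ≡⟨ ap j h ⟨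
      pos (f j) + pos (f (2 + j))             ≤⟨ +-mono-≤ (proj₂ (high m″)) (low m) ⟩
      o + w + T                               ∎))
      where open ≤-Reasoning
  ... | inj₁ m₀ | inj₂ m₁ = ⊥-elim (<⇒≱ crossing (begin
      o + o                   ≤⟨ +-mono-≤ (proj₁ (high m₁)) (proj₁ (high m₁)) ⟩
      pos (f 1) + pos (f 1)   ≡⟨ ap 0 3≤k ⟨
      pos (f 0) + pos (f 2)   ≤⟨ +-mono-≤ (low m₀) f2≤ ⟩
      T + (o + w)             ≡⟨ +-comm T (o + w) ⟩
      o + w + T               ∎))
    where
    open ≤-Reasoning
    f2≤ : pos (f 2) ≤ o + w
    f2≤ with ∈-++⁻ xs (f∈ 3≤k)
    ... | inj₁ m = ≤-trans (low m) (≤-trans (m≤m+n T T) (≤-trans (<⇒≤ 2T<o) (m≤m+n o w)))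
    ... | inj₂ m = proj₂ (high m)
  ... | inj₂ m₀ | inj₁ m₁ = ⊥-elim (<⇒≱ 2T<o (begin
      o                       ≤⟨ proj₁ (high m₀) ⟩
      pos (f 0)               ≤⟨ m≤m+n _ _ ⟩
      pos (f 0) + pos (f 2)   ≡⟨ ap 0 3≤k ⟩
      pos (f 1) + pos (f 1)   ≤⟨ +-mono-≤ (low m₁) (low m₁) ⟩
      T + T                   ∎))
    where open ≤-Reasoning

-- Edges of a k-uniform hypergraph are given as sequences of which the first k values matter. They
-- are closed under permuting these, because a progression may also be read backwards.
module Partite (k : ℕ) (3≤k : 3 ≤ k) {V : Set} (_≟V_ : DecidableEquality V) (Edge : (ℕ → V) → Set)
  (edge-injective : ∀ {y} → Edge y → ∀ {i j} → i < k → j < k → y i ≡ y j → i ≡ j)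
  (edge-resp : ∀ {y y′} → (∀ j → j < k → y j ≡ y′ j) → Edge y → Edge y′)
  (edge-reindex : ∀ {y} x → (∀ {j} → j < k → x j < k) → (∀ {i j} → i < k → j < k → x i ≡ x j → i ≡ j) → Edge y → Edge (y ∘ x))
  (Vertex : V → Set) where

  private
    0<k : 0 < k
    0<k = ≤-trans (s≤s z≤n) 3≤k
    1<k : 1 < k
    1<k = ≤-trans (s≤s (s≤s z≤n)) 3≤k

    two-others : ∀ j → ∃ λ x → ∃ λ y → x < k × y < k × x ≢ j × y ≢ j × x ≢ y
    two-others zero          = 1 , 2 , 1<k , 3≤k , (λ ()) , (λ ()) , (λ ())
    two-others (suc zero)    = 0 , 2 , 0<k , 3≤k , (λ ()) , (λ ()) , (λ ())
    two-others (suc (suc _)) = 0 , 1 , 0<k , 1<k , (λ ()) , (λ ()) , (λ ())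

    three-others : ∀ j → 4 ≤ k → ∃ λ x → ∃ λ y → ∃ λ z →
      x < k × y < k × z < k × x ≢ j × y ≢ j × z ≢ j × x ≢ y × x ≢ z × y ≢ z
    three-others zero              4≤k = 1 , 2 , 3 , 1<k , 3≤k , 4≤k , (λ ()) , (λ ()) , (λ ()) , (λ ()) , (λ ()) , (λ ())
    three-others (suc zero)        4≤k = 0 , 2 , 3 , 0<k , 3≤k , 4≤k , (λ ()) , (λ ()) , (λ ()) , (λ ()) , (λ ()) , (λ ())
    three-others (suc (suc zero))  4≤k = 0 , 1 , 3 , 0<k , 1<k , 4≤k , (λ ()) , (λ ()) , (λ ()) , (λ ()) , (λ ()) , (λ ())
    three-others (suc (suc (suc _))) 4≤k = 0 , 1 , 2 , 0<k , 1<k , 3≤k , (λ ()) , (λ ()) , (λ ()) , (λ ()) , (λ ()) , (λ ())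

  -- A finite set of labelled numbers whose label map sends nonconstant progressions, increasing or
  -- decreasing, to edges.
  record System : Set where
    field
      points       : List (ℕ × V)
      vertices     : ∀ {a u} → (a , u) ∈ points → Vertex u
      functional   : ∀ {a u u′} → (a , u) ∈ points → (a , u′) ∈ points → u ≡ u′
      progressions : ∀ x y → (∀ j → j < k → (x j , y j) ∈ points) → IsAP k x → x 0 ≢ x 1 → Edge y

  open System

  -- The partite Ramsey property: for every colouring, `P′` has a label-preserving homothetic copy
  -- of `P` in which the colour depends only on the label, for labels in `vs`.
  Contains : System → List V → ℕ → System → Set
  Contains P′ vs r P = (c : ℕ → Fin r) → ∃ λ A → ∃ λ C → Σ (V → Fin r) λ κ → 0 < A ×
    (∀ {a u} → (a , u) ∈ points P → (A * a + C , u) ∈ points P′) ×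
    (∀ {a u} → u ∈ vs → (a , u) ∈ points P → c (A * a + C) ≡ κ u)

  module Amalgam (P : System) (v : V) (r : ℕ) where

    fibre : List ℕ
    fibre = deduplicate _≟_ (map proj₁ (filter (λ p → proj₂ p ≟V v) (points P)))

    fibre⁺ : ∀ {a} → (a , v) ∈ points P → a ∈ fibre
    fibre⁺ m = ∈-deduplicate⁺ _≟_ (∈-map⁺ proj₁ (∈-filter⁺ (λ p → proj₂ p ≟V v) m refl))

    fibre⁻ : ∀ {a} → a ∈ fibre → (a , v) ∈ points P
    fibre⁻ m with ∈-map⁻ proj₁ (∈-deduplicate⁻ _≟_ _ m)
    ... | (a , u) , au∈ , refl with ∈-filter⁻ (λ p → proj₂ p ≟V v) au∈
    ...   | m′ , refl = m′

    b : ℕ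
    b = length fibre

    value : Fin b → ℕ
    value = lookup fibre

    value∈ : ∀ σ → (value σ , v) ∈ points P
    value∈ σ = fibre⁻ (∈-lookup σ)

    value-injective : ∀ σ τ → value σ ≡ value τ → σ ≡ τ
    value-injective = unique-lookup (deduplicate-! _≟_ (map proj₁ (filter (λ p → proj₂ p ≟V v) (points P))))

    F : LineFamily b
    F = proj₁ (hales-jewett b r)

    -- The base exceeds the sum of any two points, so adding two digit strings causes no carry and
    -- progressions can be examined digit by digit.
    M : ℕ
    M = suc (sum (map proj₁ (points P)) + sum (map proj₁ (points P)))

    open Digits M

    bounded : ∀ {a a′ u u′} → (a , u) ∈ points P → (a′ , u′) ∈ points P → a + a′ < M
    bounded m m′ = s≤s (+-mono-≤ (∈⇒≤sum (∈-map⁺ proj₁ m)) (∈⇒≤sum (∈-map⁺ proj₁ m′)))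

    bounded₁ : ∀ {a u} → (a , u) ∈ points P → a < M
    bounded₁ m = ≤-<-trans (m≤m+n _ _) (bounded m m)

    -- Placing `P` along the line `l` writes the point `a` at active coordinates and fibre elements
    -- at fixed ones. For `a` in the fibre this is a word of the cube.
    digit : Line F → ℕ → Coord F → ℕ
    digit l a i = maybe′ value a (template F l i)

    position : Line F → ℕ → ℕ
    position l a = encode (digit l a ∘ coord F)

    digit-active : ∀ l a {i} → template F l i ≡ nothing → digit l a i ≡ a
    digit-active l a e rewrite e = refl

    digit-fixed : ∀ l a {i σ} → template F l i ≡ just σ → digit l a i ≡ value σ
    digit-fixed l a e rewrite e = refl

    -- The label in `P` of the digit in column i, which differs from the label u of the whole point
    -- when a fibre element is written there and u is not v.
    label : Line F → V → Coord F → V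
    label l u i = maybe′ (λ _ → v) u (template F l i)

    label-active : ∀ l u {i} → template F l i ≡ nothing → label l u i ≡ u
    label-active l u e rewrite e = refl

    label-fixed : ∀ l u {i σ} → template F l i ≡ just σ → label l u i ≡ v
    label-fixed l u e rewrite e = refl

    digit∈ : ∀ l {a u} → (a , u) ∈ points P → ∀ i → (digit l a i , label l u i) ∈ points P
    digit∈ l m i with template F l i
    ... | nothing = m
    ... | just σ  = value∈ σ

    digits-equal : ∀ {l l′ a a′ u u′} → (a , u) ∈ points P → (a′ , u′) ∈ points P →
                   position l a ≡ position l′ a′ → ∀ i → digit l a i ≡ digit l′ a′ i
    digits-equal {l} {l′} {a} {a′} m m′ e i =
      subst (λ i → digit l a i ≡ digit l′ a′ i) (coord-index F i)
        (encode-injective _ _ (λ x → bounded₁ (digit∈ l m (coord F x))) (λ x → bounded₁ (digit∈ l′ m′ (coord F x))) e (index F i))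

    new-points : List (ℕ × V)
    new-points = cartesianProductWith (λ l p → position l (proj₁ p) , proj₂ p) (proj₁ (lines F)) (points P)

    new⁺ : ∀ l {a u} → (a , u) ∈ points P → (position l a , u) ∈ new-points
    new⁺ l m = ∈-cartesianProductWith⁺ (λ l p → position l (proj₁ p) , proj₂ p) (proj₂ (lines F) l) m

    new⁻ : ∀ {x u} → (x , u) ∈ new-points → ∃ λ l → ∃ λ a → (a , u) ∈ points P × x ≡ position l a
    new⁻ m with ∈-cartesianProductWith⁻ (λ l p → position l (proj₁ p) , proj₂ p) (proj₁ (lines F)) (points P) m
    ... | l , (a , u) , _ , au∈ , refl = l , a , au∈ , refl

    private
      -- If the second line is fixed in this column, then `a` equals a fibre element and so carries
      -- the label v.
      active-digit : ∀ {l l′ a a′ u u′ i} → (a , u) ∈ points P → (a′ , u′) ∈ points P →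
        digit l a i ≡ digit l′ a′ i → template F l i ≡ nothing →
        (a ≡ a′ × template F l′ i ≡ nothing) ⊎ u ≡ v
      active-digit {l} {l′} {a} {a′} {i = i} m m′ e act with template F l′ i in e′
      ... | nothing = inj₁ (trans (sym (digit-active l a act)) e , refl)
      ... | just σ  = inj₂ (functional P m (subst (λ z → (z , v) ∈ points P) (trans (sym e) (digit-active l a act)) (value∈ σ)))

    new-vertices : ∀ {x u} → (x , u) ∈ new-points → Vertex u
    new-vertices m = vertices P (proj₁ (proj₂ (proj₂ (new⁻ m))))

    -- At an active coordinate of either line, the two underlying points coincide or the point on
    -- that line is labelled v. If they never coincide, both labels are v.
    new-functional : ∀ {x u u′} → (x , u) ∈ new-points → (x , u′) ∈ new-points → u ≡ u′
    new-functional m m′ with new⁻ m | new⁻ m′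
    ... | l , a , au∈ , refl | l′ , a′ , au′∈ , e with active F l | active F l′
    ... | i , act | i′ , act′
      with active-digit {l} {l′} {i = i} au∈ au′∈ (digits-equal au∈ au′∈ e i) act
         | active-digit {l′} {l} {i = i′} au′∈ au∈ (sym (digits-equal au∈ au′∈ e i′)) act′
    ... | inj₁ (refl , _) | _               = functional P au∈ au′∈
    ... | inj₂ _          | inj₁ (refl , _) = functional P au∈ au′∈
    ... | inj₂ u≡v        | inj₂ u′≡v       = trans u≡v (sym u′≡v)

    module Progression (l : ℕ → Line F) (a : ℕ → ℕ) (u : ℕ → V) (au∈ : ∀ j → (a j , u j) ∈ points P)
      (ap : IsAP k (λ j → position (l j) (a j))) (nonconstant : position (l 0) (a 0) ≢ position (l 1) (a 1)) where

      t : ℕ → Coord F → Maybe (Fin b)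
      t j = template F (l j)

      d : Coord F → ℕ → ℕ
      d i j = digit (l j) (a j) i

      λs : Coord F → ℕ → V
      λs i j = label (l j) (u j) i

      d∈ : ∀ i j → (d i j , λs i j) ∈ points P
      d∈ i j = digit∈ (l j) (au∈ j) i

      d-active : ∀ {i j} → t j i ≡ nothing → d i j ≡ a j
      d-active {i} {j} e = digit-active (l j) (a j) e

      -- Sums of two digits stay below `M`, so the equation between the encoded numbers holds in
      -- each digit.
      d-ap : ∀ i → IsAP k (d i)
      d-ap i j h = subst (λ i → d i j + d i (2 + j) ≡ d i (1 + j) + d i (1 + j)) (coord-index F i)
        (encode-injective (λ x → d (coord F x) j + d (coord F x) (2 + j)) (λ x → d (coord F x) (1 + j) + d (coord F x) (1 + j))
          (λ x → bounded (d∈ (coord F x) j) (d∈ (coord F x) (2 + j)))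
          (λ x → bounded (d∈ (coord F x) (1 + j)) (d∈ (coord F x) (1 + j)))
          (trans (encode-+ (λ x → d (coord F x) j) _) (trans (ap j h) (sym (encode-+ (λ x → d (coord F x) (1 + j)) _))))
          (index F i))

      column-edge : ∀ {i} → d i 0 ≢ d i 1 → Edge (λs i)
      column-edge {i} n = progressions P (d i) (λs i) (λ j _ → d∈ i j) (d-ap i) n

      -- Fixed entries all carry the label v, while the labels of an edge are distinct.
      fixed-unique : ∀ {i i₁ i₂ σ τ} → d i 0 ≢ d i 1 → i₁ < k → i₂ < k → t i₁ i ≡ just σ → t i₂ i ≡ just τ → i₁ ≡ i₂
      fixed-unique {i} {i₁} {i₂} n h₁ h₂ e₁ e₂ = edge-injective (column-edge n) h₁ h₂
        (trans (label-fixed (l i₁) (u i₁) e₁) (sym (label-fixed (l i₂) (u i₂) e₂)))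

      -- The progression changes in column i, where its j₀-th term shows a letter of the fibre
      -- although it is not labelled by v.
      module Stray {i : Coord F} (n : d i 0 ≢ d i 1) {j₀ : ℕ} (j₀<k : j₀ < k) {σ : Fin b}
                   (fix : t j₀ i ≡ just σ) (u≢v : u j₀ ≢ v) where

        others-active : ∀ {j} → j < k → j ≢ j₀ → t j i ≡ nothing
        others-active {j} j<k j≢j₀ with t j i in e
        ... | nothing = refl
        ... | just τ  = ⊥-elim (j≢j₀ (fixed-unique n j<k j₀<k e fix))

        no-label-v : ∀ {j} → j < k → u j ≢ v
        no-label-v {j} j<k e with j ≟ j₀
        ... | yes refl = u≢v e
        ... | no j≢j₀  = j≢j₀ (edge-injective (column-edge n) j<k j₀<k
                (trans (label-active (l j) (u j) (others-active j<k j≢j₀)) (trans e (sym (label-fixed (l j₀) (u j₀) fix)))))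

        a≢fixed : ∀ {j} → j < k → ∀ {τ} → a j ≢ value τ
        a≢fixed j<k {τ} e = no-label-v j<k (functional P (au∈ _) (subst (λ z → (z , v) ∈ points P) (sym e) (value∈ τ)))

        -- The columns i and i′ would agree at x and y, hence also at `j₀`. There column i shows a
        -- fibre element and column i′ shows a point not labelled v.
        two-active : ∀ {i′ x y} → x < k → y < k → x ≢ j₀ → y ≢ j₀ → x ≢ y →
                     t x i′ ≡ nothing → t y i′ ≡ nothing → t j₀ i′ ≡ nothing → ⊥
        two-active {i′} x<k y<k x≢ y≢ x≢y ex ey e₀ = a≢fixed j₀<k
          (trans (sym (d-active e₀)) (trans (sym agree) (digit-fixed (l j₀) (a j₀) fix)))
          where
          agree : d i j₀ ≡ d i′ j₀
          agree = ap-determined (d i) (d i′) (d-ap i) (d-ap i′) x<k y<k x≢y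
            (trans (d-active (others-active x<k x≢)) (sym (d-active ex)))
            (trans (d-active (others-active y<k y≢)) (sym (d-active ey))) j₀ j₀<k

        -- An active entry in a constant column is not in the fibre, so all terms would be active
        -- there with the same point. Column i, active at two further terms, would then repeat a
        -- value.
        constant-fixed : ∀ {i′} → d i′ 0 ≡ d i′ 1 → ∀ {j} → j < k → t j i′ ≢ nothing
        constant-fixed {i′} e {j} j<k act with two-others j₀
        ... | x , y , x<k , y<k , x≢ , y≢ , x≢y = x≢y (ap-injective 1<k (d i) (d-ap i) n x<k y<k
              (trans (d-active (others-active x<k x≢)) (trans (same x<k) (trans (sym (same y<k)) (sym (d-active (others-active y<k y≢)))))))
          where
          const : ∀ j → j < k → d i′ j ≡ d i′ 0
          const = ap-constant (d i′) (d-ap i′) e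
          same : ∀ {x} → x < k → a x ≡ a j
          same {x} x<k with active-digit {l j} {l x} {i = i′} (au∈ j) (au∈ x) (trans (const j j<k) (sym (const x x<k))) act
          ... | inj₁ (ajx , _) = sym ajx
          ... | inj₂ uj≡v      = ⊥-elim (no-label-v j<k uj≡v)

        module FourTerms (4≤k : 4 ≤ k) where

          -- A column where the line of `j₀` is active must change, so it has at most one fixed
          -- entry. Among three further terms two are active, against `two-active`.
          impossible : ⊥
          impossible with active F (l j₀) | three-others j₀ 4≤k
          ... | i′ , act | x , y , z , x<k , y<k , z<k , x≢ , y≢ , z≢ , x≢y , x≢z , y≢z = cases _ _ _ refl refl refl
            where
            n′ : d i′ 0 ≢ d i′ 1
            n′ e = constant-fixed e j₀<k act
            cases : ∀ p q s → t x i′ ≡ p → t y i′ ≡ q → t z i′ ≡ s → ⊥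
            cases nothing  nothing  _        ex ey ez = two-active x<k y<k x≢ y≢ x≢y ex ey act
            cases nothing  (just _) nothing  ex ey ez = two-active x<k z<k x≢ z≢ x≢z ex ez act
            cases (just _) nothing  nothing  ex ey ez = two-active y<k z<k y≢ z≢ y≢z ey ez act
            cases (just _) (just _) _        ex ey ez = x≢y (fixed-unique n′ x<k y<k ex ey)
            cases (just _) nothing  (just _) ex ey ez = x≢z (fixed-unique n′ x<k z<k ex ez)
            cases nothing  (just _) (just _) ex ey ez = y≢z (fixed-unique n′ y<k z<k ey ez)

        -- Constant columns are fixed with a common letter. Changing columns have at most one fixed
        -- entry and, by `two-active`, at least one. So every column clashes, which the family of
        -- lines excludes.
        impossible₃ : k ≡ 3 → ⊥
        impossible₃ refl = clash-free F (l 0) (l 1) (l 2) λ i′ → column i′ _ _ _ refl refl refl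
          where
          fixed-letters : ∀ {i′ j σ τ} → d i′ 0 ≡ d i′ 1 → j < k → t 0 i′ ≡ just σ → t j i′ ≡ just τ → σ ≡ τ
          fixed-letters {i′} {j} e j<k e₀ e₁ = value-injective _ _
            (trans (sym (digit-fixed (l 0) (a 0) e₀)) (trans (sym (ap-constant (d i′) (d-ap i′) e j j<k)) (digit-fixed (l j) (a j) e₁)))

          column : ∀ i′ p q s → t 0 i′ ≡ p → t 1 i′ ≡ q → t 2 i′ ≡ s → Clash (t 0 i′) (t 1 i′) (t 2 i′)
          column i′ p q s e₀ e₁ e₂ with d i′ 0 ≟ d i′ 1
          column i′ nothing  _ _ e₀ e₁ e₂ | yes e = ⊥-elim (constant-fixed e 0<k e₀)
          column i′ (just _) nothing  _ e₀ e₁ e₂ | yes e = ⊥-elim (constant-fixed e 1<k e₁)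
          column i′ (just _) (just _) nothing  e₀ e₁ e₂ | yes e = ⊥-elim (constant-fixed e 3≤k e₂)
          column i′ (just σ) (just τ) (just ρ) e₀ e₁ e₂ | yes e
            with fixed-letters e 1<k e₀ e₁ | fixed-letters e 3≤k e₀ e₂
          ... | refl | refl rewrite e₀ | e₁ | e₂ = fixed σ
          column i′ nothing nothing (just ρ) e₀ e₁ e₂ | no n′ rewrite e₀ | e₁ | e₂ = third ρ
          column i′ nothing (just ρ) nothing e₀ e₁ e₂ | no n′ rewrite e₀ | e₁ | e₂ = second ρ
          column i′ (just ρ) nothing nothing e₀ e₁ e₂ | no n′ rewrite e₀ | e₁ | e₂ = first ρ
          column i′ (just _) (just _) _ e₀ e₁ e₂ | no n′ = case fixed-unique n′ 0<k 1<k e₀ e₁ of λ ()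
          column i′ (just _) nothing (just _) e₀ e₁ e₂ | no n′ = case fixed-unique n′ 0<k 3≤k e₀ e₂ of λ ()
          column i′ nothing (just _) (just _) e₀ e₁ e₂ | no n′ = case fixed-unique n′ 1<k 3≤k e₁ e₂ of λ ()
          column i′ nothing nothing nothing e₀ e₁ e₂ | no n′ with two-others j₀
          ... | x , y , x<k , y<k , x≢ , y≢ , x≢y = ⊥-elim (two-active x<k y<k x≢ y≢ x≢y (all x<k) (all y<k) (all j₀<k))
            where
            all : ∀ {j} → j < 3 → t j i′ ≡ nothing
            all {0} _ = e₀
            all {1} _ = e₁
            all {2} _ = e₂
            all {suc (suc (suc _))} (s≤s (s≤s (s≤s ())))

        impossible : ⊥
        impossible with m≤n⇒m<n∨m≡n 3≤k
        ... | inj₁ 4≤k = FourTerms.impossible 4≤k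
        ... | inj₂ 3≡k = impossible₃ (sym 3≡k)

      changing-column : ∃ λ i → d i 0 ≢ d i 1
      changing-column with ¬∀⟶∃¬ (size F) (λ x → d (coord F x) 0 ≡ d (coord F x) 1) (λ x → d (coord F x) 0 ≟ d (coord F x) 1)
                             (λ e → nonconstant (encode-cong e))
      ... | x , n = coord F x , n

      -- In a changing column the digit labels form an edge of the old system, and they agree with
      -- the new labels because stray entries are impossible.
      edge : Edge u
      edge with changing-column
      ... | i , n = edge-resp agree (column-edge n)
        where
        agree : ∀ j → j < k → λs i j ≡ u j
        agree j j<k with t j i in e
        ... | nothing = refl
        ... | just σ with u j ≟V v
        ...   | yes u≡v = sym u≡v
        ...   | no  u≢v = ⊥-elim (Stray.impossible n j<k e u≢v)

    -- Extends data given for indices below k to all indices, as `Progression` expects.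
    clamp : ℕ → ℕ
    clamp j = j ⊓ pred k

    clamp<k : ∀ j → clamp j < k
    clamp<k j = ≤-trans (s≤s (m⊓n≤n j (pred k))) (≤-reflexive (suc-pred k {{>-nonZero 0<k}}))

    clamp-id : ∀ {j} → j < k → clamp j ≡ j
    clamp-id {j} j<k = m≤n⇒m⊓n≡m (≤-pred (≤-trans j<k (≤-reflexive (sym (suc-pred k {{>-nonZero 0<k}})))))

    new-progressions : ∀ x y → (∀ j → j < k → (x j , y j) ∈ new-points) → IsAP k x → x 0 ≢ x 1 → Edge y
    new-progressions x y m ap n =
      edge-resp (λ j j<k → cong y (clamp-id j<k))
        (Progression.edge (λ j → proj₁ (source j)) (λ j → proj₁ (proj₂ (source j))) (λ j → y (clamp j))
          (λ j → proj₁ (proj₂ (proj₂ (source j))))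
          (λ j h → trans (sym (cong₂ _+_ (x-source (<-trans (n<1+n _) (<-trans (n<1+n _) h))) (x-source h)))
                     (trans (ap j h) (cong₂ _+_ (x-source (<-trans (n<1+n _) h)) (x-source (<-trans (n<1+n _) h)))))
          (λ e → n (trans (x-source 0<k) (trans e (sym (x-source 1<k))))))
      where
      source : ∀ j → ∃ λ l → ∃ λ a → (a , y (clamp j)) ∈ points P × x (clamp j) ≡ position l a
      source j = new⁻ (m (clamp j) (clamp<k j))
      x-source : ∀ {j} → j < k → x j ≡ position (proj₁ (source j)) (proj₁ (proj₂ (source j)))
      x-source {j} j<k = trans (cong x (sym (clamp-id j<k))) (proj₂ (proj₂ (proj₂ (source j))))

    system : System
    system = record { points = new-points ; vertices = new-vertices ; functional = new-functional ; progressions = new-progressions }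

    -- The base-M number with digit 1 at active coordinates and 0 elsewhere: the dilation factor of
    -- the copy of `P` along the line.
    ratio : Line F → ℕ
    ratio l = encode (λ x → maybe′ (λ _ → 0) 1 (template F l (coord F x)))

    offset : Line F → ℕ
    offset l = encode (λ x → maybe′ value 0 (template F l (coord F x)))

    position-affine : ∀ l a → position l a ≡ ratio l * a + offset l
    position-affine l a = trans (encode-cong λ x → affine (template F l (coord F x)))
      (trans (encode-+ (λ x → maybe′ (λ _ → 0) 1 (template F l (coord F x)) * a) _) (cong (_+ offset l) (encode-* (λ x → maybe′ (λ _ → 0) 1 (template F l (coord F x))) a)))
      where
      affine : ∀ m → maybe′ value a m ≡ maybe′ (λ _ → 0) 1 m * a + maybe′ value 0 m
      affine nothing  = sym (trans (+-identityʳ (a + 0)) (+-identityʳ a))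
      affine (just σ) = refl

    ratio-positive : ∀ l → 0 < ratio l
    ratio-positive l with active F l
    ... | i , act = encode-positive _ (index F i)
      (subst (λ m → 0 < maybe′ (λ _ → 0) 1 m) (sym (trans (cong (template F l) (coord-index F i)) act)) (s≤s z≤n))

    -- A monochromatic line of the cube over the fibre is a copy of the fibre in one colour, and the
    -- construction has completed it to a copy of all of `P`.
    contains : Contains system (v ∷ []) r P
    contains c with proj₂ (hales-jewett b r) (λ w → c (encode (value ∘ w ∘ coord F)))
                      (λ w w′ e → cong c (encode-cong (cong value ∘ e ∘ coord F)))
    ... | l , mono = ratio l , offset l , κ , ratio-positive l ,
          (λ {a} {u} m → subst (λ z → (z , u) ∈ new-points) (position-affine l a) (new⁺ l m)) ,
          λ { {a} (here refl) m → trans (cong c (sym (position-affine l a))) (colour m) }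
      where
      fill : ∀ σ → encode (value ∘ fill-in (template F l) σ ∘ coord F) ≡ position l (value σ)
      fill σ = encode-cong λ x → fill-digit (template F l (coord F x))
        where
        fill-digit : ∀ m → value (fromMaybe σ m) ≡ maybe′ value (value σ) m
        fill-digit nothing  = refl
        fill-digit (just _) = refl
      same : ∀ σ τ → c (position l (value σ)) ≡ c (position l (value τ))
      same σ τ = trans (cong c (sym (fill σ))) (trans (mono σ τ) (cong c (fill τ)))
      κ₀ : ∃ λ κ → ∀ σ → c (position l (value σ)) ≡ κ
      κ₀ = constant-value (c 0) (c ∘ position l ∘ value) same
      κ : V → Fin r
      κ _ = proj₁ κ₀
      colour : ∀ {a} → (a , v) ∈ points P → c (position l a) ≡ proj₁ κ₀
      colour m = trans (cong (c ∘ position l) (lookup-index (fibre⁺ m))) (proj₂ κ₀ (Any.index (fibre⁺ m)))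

  -- Amalgamation along v comes first, and the result is amalgamated along the remaining labels.
  -- Colourings are treated in the reverse order; passing to the inner copy preserves labels and so
  -- keeps the fibres already monochromatic.
  contains-all : ∀ vs r P → ∃ λ P′ → Contains P′ vs r P
  contains-all []       r P = P , λ c → 1 , 0 , (λ _ → c 0) , s≤s z≤n ,
    (λ {a} {u} m → subst (λ z → (z , u) ∈ points P) (sym (trans (+-identityʳ (a + 0)) (+-identityʳ a))) m) , λ ()
  contains-all (v ∷ vs) r P with contains-all vs r (Amalgam.system P v r)
  ... | P″ , inner = P″ , λ c → combine-copies c
    where
    combine-copies : Contains P″ (v ∷ vs) r P
    combine-copies c with inner c
    ... | A₂ , C₂ , κ₂ , A₂>0 , copy₂ , mono₂ with Amalgam.contains P v r (λ a → c (A₂ * a + C₂))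
    ...   | A₁ , C₁ , κ₁ , A₁>0 , copy₁ , mono₁ =
      A₂ * A₁ , A₂ * C₁ + C₂ , κ , *-mono-≤ A₂>0 A₁>0 ,
      (λ {a} {u} m → subst (λ z → (z , u) ∈ points P″) (affine a) (copy₂ (copy₁ m))) , mono
      where
      affine : ∀ a → A₂ * (A₁ * a + C₁) + C₂ ≡ A₂ * A₁ * a + (A₂ * C₁ + C₂)
      affine a = solve 5 (λ a A₁ C₁ A₂ C₂ → A₂ :* (A₁ :* a :+ C₁) :+ C₂ := A₂ :* A₁ :* a :+ (A₂ :* C₁ :+ C₂)) refl a A₁ C₁ A₂ C₂
      κ : V → Fin r
      κ u with u ≟V v
      ... | yes _ = κ₁ u
      ... | no  _ = κ₂ u
      mono : ∀ {a u} → u ∈ v ∷ vs → (a , u) ∈ points P → c (A₂ * A₁ * a + (A₂ * C₁ + C₂)) ≡ κ u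
      mono {a} {u} u∈ m with u ≟V v
      ... | yes u≡v = trans (cong c (sym (affine a))) (mono₁ (here u≡v) m)
      ... | no  u≢v with u∈
      ...   | here u≡v   = ⊥-elim (u≢v u≡v)
      ...   | there u∈vs = trans (cong c (sym (affine a))) (mono₂ u∈vs (copy₁ m))

  -- Disjoint copies of all edges

  module AddEdge (P : System) (e : ℕ → V) (e-edge : Edge e) (e-vertex : ∀ {j} → j < k → Vertex (e j)) where

    private
      T o : ℕ
      T = sum (map proj₁ (points P))
      o = suc (k + (T + T))

      piece : List (ℕ × V)
      piece = map (λ j → o + j , e j) (upTo k)

      piece⁻ : ∀ {a u} → (a , u) ∈ piece → ∃ λ j → j < k × a ≡ o + j × u ≡ e j
      piece⁻ m with ∈-map⁻ (λ j → o + j , e j) m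
      ... | j , j∈ , refl = j , ∈-upTo⁻ j∈ , refl , refl

      low : ∀ {p} → p ∈ points P → proj₁ p ≤ T
      low m = ∈⇒≤sum (∈-map⁺ proj₁ m)

      high : ∀ {p} → p ∈ piece → o ≤ proj₁ p × proj₁ p ≤ o + k
      high m with piece⁻ m
      ... | j , j<k , refl , _ = m≤m+n o j , +-monoʳ-≤ o (<⇒≤ j<k)

      apart : ∀ {p p′} → p ∈ points P → p′ ∈ piece → proj₁ p ≢ proj₁ p′
      apart = low≢high 3≤k proj₁ {w = k} ≤-refl low high

      -- A progression of k distinct terms inside k consecutive numbers permutes them, so its labels
      -- are a reindexing of `e`.
      in-piece : ∀ x y → (∀ {j} → j < k → (x j , y j) ∈ piece) → IsAP k x → x 0 ≢ x 1 → Edge y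
      in-piece x y m ap n = edge-resp (λ j j<k → sym (label-of j<k))
        (edge-reindex (λ j → x j ∸ o) bound (λ i<k j<k eq → ap-injective 1<k x ap n i<k j<k
          (trans (sym (shift i<k)) (trans (cong (o +_) eq) (shift j<k)))) e-edge)
        where
        shift : ∀ {j} → j < k → o + (x j ∸ o) ≡ x j
        shift j<k = m+[n∸m]≡n (proj₁ (high (m j<k)))
        index-of : ∀ {j} (j<k : j < k) → x j ∸ o ≡ proj₁ (piece⁻ (m j<k))
        index-of j<k with piece⁻ (m j<k)
        ... | i , _ , xj≡ , _ = trans (cong (_∸ o) xj≡) (m+n∸m≡n o i)
        bound : ∀ {j} → j < k → x j ∸ o < k
        bound j<k = subst (_< k) (sym (index-of j<k)) (proj₁ (proj₂ (piece⁻ (m j<k))))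
        label-of : ∀ {j} → j < k → y j ≡ e (x j ∸ o)
        label-of j<k = trans (proj₂ (proj₂ (proj₂ (piece⁻ (m j<k))))) (cong e (sym (index-of j<k)))

    system : System
    system = record
      { points       = points P ++ piece
      ; vertices     = λ m → case ∈-++⁻ (points P) m of λ
          { (inj₁ m) → vertices P m
          ; (inj₂ m) → let (j , j<k , _ , u≡) = piece⁻ m in subst Vertex (sym u≡) (e-vertex j<k) }
      ; functional   = λ m m′ → functional′ (∈-++⁻ (points P) m) (∈-++⁻ (points P) m′)
      ; progressions = λ x y m ap n → case split-progression 3≤k proj₁ {w = k} ≤-refl low high (λ j → x j , y j) (λ {j} → m j) ap of λ
          { (inj₁ m) → progressions P x y (λ j → m) ap n
          ; (inj₂ m) → in-piece x y m ap n }
      }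
      where
      functional′ : ∀ {a u u′} → (a , u) ∈ points P ⊎ (a , u) ∈ piece → (a , u′) ∈ points P ⊎ (a , u′) ∈ piece → u ≡ u′
      functional′ (inj₁ m) (inj₁ m′) = functional P m m′
      functional′ (inj₁ m) (inj₂ m′) = ⊥-elim (apart m m′ refl)
      functional′ (inj₂ m) (inj₁ m′) = ⊥-elim (apart m′ m refl)
      functional′ (inj₂ m) (inj₂ m′) with piece⁻ m | piece⁻ m′
      ... | j , _ , refl , refl | j′ , _ , eq , refl = cong e (+-cancelˡ-≡ o j j′ eq)

    old : ∀ {p} → p ∈ points P → p ∈ points system
    old = ∈-++⁺ˡ

    added : ∃ λ o → ∀ {j} → j < k → (o + j , e j) ∈ points system
    added = o , λ j<k → ∈-++⁺ʳ (points P) (∈-map⁺ (λ j → o + j , e j) (∈-upTo⁺ j<k))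

  disjoint-edges : ∀ es → (∀ {e} → e ∈ es → Edge e × (∀ {j} → j < k → Vertex (e j))) →
    Σ System λ P → ∀ {e} → e ∈ es → ∃ λ o → ∀ {j} → j < k → (o + j , e j) ∈ points P
  disjoint-edges [] h = record
    { points = [] ; vertices = λ () ; functional = λ () ; progressions = λ x y m _ _ → case m 0 0<k of λ () } , λ ()
  disjoint-edges (e ∷ es) h with disjoint-edges es (h ∘ there)
  ... | P , copies = A.system , λ
    { (here refl) → A.added
    ; (there m)   → let (o , c) = copies m in o , λ j<k → A.old (c j<k) }
    where module A = AddEdge P e (proj₁ (h (here refl))) (proj₂ (h (here refl)))

-- Windows of decreasing sequences

Decreasing : ℕ → List ℕ → Set
Decreasing N []      = ⊤
Decreasing N (j ∷ u) = j < N × Decreasing j u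

decreasing? : ∀ N u → Dec (Decreasing N u)
decreasing? N []      = yes tt
decreasing? N (j ∷ u) = (j <? N) ×-dec decreasing? j u

decreasing-weaken : ∀ {M N} u → M ≤ N → Decreasing M u → Decreasing N u
decreasing-weaken []      M≤N _         = tt
decreasing-weaken (j ∷ u) M≤N (j<M , h) = <-≤-trans j<M M≤N , h

decreasing-drop : ∀ {N} n u → Decreasing N u → Decreasing N (drop n u)
decreasing-drop zero    u       h         = h
decreasing-drop (suc n) []      h         = tt
decreasing-drop (suc n) (j ∷ u) (j<N , h) = decreasing-weaken (drop n u) (<⇒≤ j<N) (decreasing-drop n u h)

decreasing-take : ∀ {N} n u → Decreasing N u → Decreasing N (take n u)
decreasing-take zero    u       h         = tt
decreasing-take (suc n) []      h         = tt
decreasing-take (suc n) (j ∷ u) (j<N , h) = j<N , decreasing-take n u h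

decreasing-lists : ℕ → ℕ → List (List ℕ)
decreasing-lists N zero    = [] ∷ []
decreasing-lists N (suc n) = concatMap (λ j → map (j ∷_) (decreasing-lists j n)) (upTo N)

decreasing-lists⁺ : ∀ {N} u → Decreasing N u → u ∈ decreasing-lists N (length u)
decreasing-lists⁺ []      _         = here refl
decreasing-lists⁺ (j ∷ u) (j<N , h) = ∈-concatMap⁺ (λ j → map (j ∷_) (decreasing-lists j (length u)))
  (Any.map (λ { refl → ∈-map⁺ (j ∷_) (decreasing-lists⁺ u h) }) (∈-upTo⁺ j<N))

decreasing-lists⁻ : ∀ {N} n {u} → u ∈ decreasing-lists N n → Decreasing N u × length u ≡ n
decreasing-lists⁻ zero (here refl) = tt , refl
decreasing-lists⁻ {N} (suc n) m with find (∈-concatMap⁻ (λ j → map (j ∷_) (decreasing-lists j n)) {xs = upTo N} m)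
... | j , j∈ , m′ with ∈-map⁻ (j ∷_) m′
... | u , u∈ , refl with decreasing-lists⁻ n u∈
... | h , e = (∈-upTo⁻ j∈ , h) , cong suc e

take-take : ∀ m (u : List ℕ) → take m (take (suc m) u) ≡ take m u
take-take zero    u       = refl
take-take (suc m) []      = refl
take-take (suc m) (x ∷ u) = cong (x ∷_) (take-take m u)

-- Iterated shift graphs: a labelling of longer windows colours the edges between shorter ones. By
-- induction some edge joins windows with equal walk codes, and the resulting two-step walk has two
-- successive edges of one colour.
repeated-window : ∀ m Q → ∃ λ N → ∀ (f : List ℕ → Fin Q) → ∃ λ x → Σ (Fin N) λ j →
  length x ≡ suc m × Decreasing (toℕ j) x × f x ≡ f (take (suc m) (toℕ j ∷ x))
repeated-window zero Q = suc Q , λ f → case pigeonhole (n<1+n Q) (λ i → f (toℕ i ∷ [])) of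
  λ { (i , j , i<j , e) → (toℕ i ∷ []) , j , refl , (i<j , tt) , e }
repeated-window (suc m) Q with repeated-window m (2 ^ (Q * 3))
... | N , repeated = N , main
  where
  main : ∀ (f : List ℕ → Fin Q) → ∃ λ x → Σ (Fin N) λ j →
    length x ≡ 2 + m × Decreasing (toℕ j) x × f x ≡ f (take (2 + m) (toℕ j ∷ x))
  main f = longer
    where
    open Walks {N = N} (λ x j → take (suc m) (toℕ j ∷ x)) (λ x j → Decreasing (toℕ j) x)
               (λ x j → decreasing? (toℕ j) x) (λ x j → f (toℕ j ∷ x))
    longer : ∃ λ x → Σ (Fin N) λ j →
      length x ≡ 2 + m × Decreasing (toℕ j) x × f x ≡ f (take (2 + m) (toℕ j ∷ x))
    longer with repeated (walks 2)
    ... | x , j , len , dec , e with walk-of-repetition 2 x j dec e 2 ≤-refl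
    ...   | j₁ , d₁ , e₁ , j₂ , d₂ , e₂ , tt = toℕ j₁ ∷ x , j₂ , cong suc len , (proj₁ d₂ , d₁) , trans e₁ (sym e₂)

abstract
  -- The same argument with walks of k steps: a monochromatic walk spells out a decreasing sequence
  -- whose k successive windows are its edges.
  window-ramsey : ∀ m k R → ∃ λ N → ∀ (c : List ℕ → Fin R) → ∃ λ U → ∃ λ γ →
    Decreasing N U × length U ≡ k + suc m × (∀ s → s < k → c (take (2 + m) (drop s U)) ≡ γ)
  window-ramsey m k R with repeated-window m (2 ^ (R * suc k))
  ... | N , repeated = N , main
    where
    main : ∀ (c : List ℕ → Fin R) → ∃ λ U → ∃ λ γ →
      Decreasing N U × length U ≡ k + suc m × (∀ s → s < k → c (take (2 + m) (drop s U)) ≡ γ)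
    main c = unrolled
      where
      open Walks {N = N} (λ x j → take (suc m) (toℕ j ∷ x)) (λ x j → Decreasing (toℕ j) x)
                 (λ x j → decreasing? (toℕ j) x) (λ x j → c (toℕ j ∷ x))

      top : ∀ {N j} U → Decreasing N U → Decreasing j (take (suc m) U) → Decreasing j U
      top []      _ _         = tt
      top (h ∷ U) (_ , d) (h<j , _) = h<j , d

      -- Each step prepends an entry, so the first edge of the walk becomes the last of the t
      -- windows.
      unroll : ∀ γ t U₀ → Decreasing N U₀ → Walk γ t (take (suc m) U₀) → ∃ λ U →
        Decreasing N U × length U ≡ t + length U₀ × drop t U ≡ U₀ × (∀ s → s < t → c (take (2 + m) (drop s U)) ≡ γ)
      unroll γ zero    U₀ d w = U₀ , d , refl , refl , λ _ ()
      unroll γ (suc t) U₀ d (j , ok , e , w)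
        with unroll γ t (toℕ j ∷ U₀) (toℕ<n j , top U₀ d ok)
               (subst (Walk γ t) (cong (toℕ j ∷_) (take-take m U₀)) w)
      ... | U , dU , len , dr , col = U , dU , trans len (+-suc t (length U₀)) ,
            trans (sym (trans (drop-drop t 1 U) (cong (λ n → drop n U) (+-comm t 1)))) (cong (drop 1) dr) , windows
        where
        windows : ∀ s → s < suc t → c (take (2 + m) (drop s U)) ≡ γ
        windows s (s≤s s≤t) with m≤n⇒m<n∨m≡n s≤t
        ... | inj₁ s<t  = col s s<t
        ... | inj₂ refl = trans (cong (λ z → c (take (2 + m) z)) dr) e

      full : ∀ n (x : List ℕ) → length x ≡ n → take n x ≡ x
      full zero    []      _ = refl
      full (suc n) (a ∷ x) e = cong (a ∷_) (full n x (suc-injective e))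

      unrolled : ∃ λ U → ∃ λ γ → Decreasing N U × length U ≡ k + suc m × (∀ s → s < k → c (take (2 + m) (drop s U)) ≡ γ)
      unrolled with repeated (walks k)
      ... | x , j , len , dec , e with unroll (c (toℕ j ∷ x)) k x (decreasing-weaken x (<⇒≤ (toℕ<n j)) dec)
                  (subst (Walk _ k) (sym (full (suc m) x len)) (walk-of-repetition k x j dec e k ≤-refl))
      ...   | U , dU , lenU , _ , col = U , _ , dU , trans lenU (cong (k +_) len) , col

-- First marked entries and residue classes

-- The index of the first marked entry. It is the length of the list if nothing is marked, so a
-- value below the length certifies a mark.
lead : (ℕ → Bool) → List ℕ → ℕ
lead ω []      = 0
lead ω (x ∷ u) = if ω x then 0 else suc (lead ω u)

lead-take : ∀ ω n u → lead ω (take n u) ≡ lead ω u ⊓ n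
lead-take ω zero    u       = sym (⊓-zeroʳ (lead ω u))
lead-take ω (suc n) []      = refl
lead-take ω (suc n) (x ∷ u) with ω x
... | true  = refl
... | false = cong suc (lead-take ω n u)

lead-drop : ∀ ω n u → n ≤ lead ω u → lead ω (drop n u) ≡ lead ω u ∸ n
lead-drop ω zero    u       h = refl
lead-drop ω (suc n) (x ∷ u) h with ω x
lead-drop ω (suc n) (x ∷ u) () | true
lead-drop ω (suc n) (x ∷ u) (s≤s h) | false = lead-drop ω n u h

window : ℕ → List ℕ → ℕ → List ℕ
window L U j = take L (drop j U)

window-injective-< : ∀ L {N} U → Decreasing N U → ∀ {i j} → i < j → j < length U → window (suc L) U i ≢ window (suc L) U j
window-injective-< L (h ∷ U) (_ , d) {zero}  {suc j} _ _ e with drop j U | decreasing-drop j U d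
... | []     | _           = case e of λ ()
... | x ∷ U′ | (x<h , _) = ⊥-elim (<-irrefl (sym (∷-injectiveˡ e)) x<h)
window-injective-< L (h ∷ U) (_ , d) {suc i} {suc j} (s≤s i<j) (s≤s j<) e = window-injective-< L U d i<j j< e

window-injective : ∀ L {N} U → Decreasing N U → ∀ {i j} → i < length U → j < length U →
                   window (suc L) U i ≡ window (suc L) U j → i ≡ j
window-injective L U d {i} {j} i< j< e with <-cmp i j
... | tri< i<j _ _ = ⊥-elim (window-injective-< L U d i<j j< e)
... | tri≈ _ i≡j _ = i≡j
... | tri> _ _ j<i = ⊥-elim (window-injective-< L U d j<i i< (sym e))

-- Take j to be the remainder of p - s.
residue-shift : ∀ k .{{_ : NonZero k}} p s → s < k → s ≤ p → ∃ λ j → j < k × j ≤ p × (p ∸ j) % k ≡ s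
residue-shift k p s s<k s≤p = (p ∸ s) % k , m%n<n (p ∸ s) k , ≤-trans (m%n≤m (p ∸ s) k) (m∸n≤m p s) ,
  trans (cong (_% k) (trans (cong (_∸ ((p ∸ s) % k)) split) (m+n∸n≡m (s + (p ∸ s) / k * k) ((p ∸ s) % k))))
    (trans ([m+kn]%n≡m%n s ((p ∸ s) / k) k) (m<n⇒m%n≡m s<k))
  where
  split : p ≡ s + (p ∸ s) / k * k + (p ∸ s) % k
  split = begin
    p                                           ≡⟨ m+[n∸m]≡n s≤p ⟨
    s + (p ∸ s)                                 ≡⟨ cong (s +_) (m≡m%n+[m/n]*n (p ∸ s) k) ⟩
    s + ((p ∸ s) % k + (p ∸ s) / k * k)         ≡⟨ cong (s +_) (+-comm ((p ∸ s) % k) _) ⟩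
    s + ((p ∸ s) / k * k + (p ∸ s) % k)         ≡⟨ +-assoc s _ _ ⟨
    s + (p ∸ s) / k * k + (p ∸ s) % k           ∎
    where open ≡-Reasoning

module Selection (k : ℕ) .{{_ : NonZero k}} (L : ℕ) where

  -- The lower bound keeps the first mark inside the window under up to k - 1 shifts; the upper
  -- bound guarantees a mark in a window of length `L`.
  Good : (ℕ → Bool) → List ℕ → Set
  Good ω x = pred k ≤ lead ω x × lead ω x < L

  good? : ∀ ω x → Dec (Good ω x)
  good? ω x = (pred k ≤? lead ω x) ×-dec (lead ω x <? L)

  Selected : (ℕ → Bool) → ℕ → List ℕ → Set
  Selected ω s x = Good ω x × lead ω x % k ≢ s

  selected? : ∀ ω s x → Dec (Selected ω s x)
  selected? ω s x = good? ω x ×-dec ¬? (lead ω x % k ≟ s)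

  -- If the zeroth window is good then its first marked entry is the first marked entry of all
  -- k windows, and its position in them runs through all residues modulo k.
  windows-hit : ∀ U ω s → s < k → ∃ λ j → j < k × ¬ Selected ω s (window L U j)
  windows-hit U ω s s<k with good? ω (window L U 0)
  ... | no  bad = 0 , >-nonZero⁻¹ k , λ sel → bad (proj₁ sel)
  ... | yes (k≤ , <L) = hit (residue-shift k (lead ω U) s s<k (≤-trans s≤pred (≤-trans k≤ (≤-trans (≤-reflexive (lead-take ω L U)) (m⊓n≤m _ L)))))
    where
    s≤pred : s ≤ pred k
    s≤pred = ≤-pred (≤-trans s<k (≤-reflexive (sym (suc-pred k))))
    p<L : lead ω U < L
    p<L with ≤-total (lead ω U) L
    ... | inj₁ p≤L = subst (_< L) (trans (lead-take ω L U) (m≤n⇒m⊓n≡m p≤L)) <L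
    ... | inj₂ L≤p = ⊥-elim (<-irrefl (trans (lead-take ω L U) (m≥n⇒m⊓n≡n L≤p)) <L)
    hit : (∃ λ j → j < k × j ≤ lead ω U × (lead ω U ∸ j) % k ≡ s) → ∃ λ j → j < k × ¬ Selected ω s (window L U j)
    hit (j , j<k , j≤p , e) = j , j<k , λ sel → proj₂ sel (trans (cong (_% k) shifted) e)
      where
      shifted : lead ω (window L U j) ≡ lead ω U ∸ j
      shifted = trans (lead-take ω L (drop j U))
        (trans (cong (_⊓ L) (lead-drop ω j U j≤p)) (m≤n⇒m⊓n≡m (≤-trans (m∸n≤m (lead ω U) j) (<⇒≤ p<L))))

-- Random markings

𝟙 : ∀ {P : Set} → Dec P → ℕ
𝟙 (yes _) = 1
𝟙 (no  _) = 0

𝟙-cong : ∀ {P Q : Set} (p? : Dec P) (q? : Dec Q) → (P → Q) → (Q → P) → 𝟙 p? ≡ 𝟙 q?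
𝟙-cong (yes _) (yes _) _ _ = refl
𝟙-cong (yes p) (no ¬q) f _ = ⊥-elim (¬q (f p))
𝟙-cong (no ¬p) (yes q) _ g = ⊥-elim (¬p (g q))
𝟙-cong (no _)  (no _)  _ _ = refl

𝟙-no : ∀ {P : Set} (p? : Dec P) → ¬ P → 𝟙 p? ≡ 0
𝟙-no (yes p) ¬p = ⊥-elim (¬p p)
𝟙-no (no _)  _  = refl

𝟙-yes : ∀ {P : Set} (p? : Dec P) → P → 𝟙 p? ≡ 1
𝟙-yes (yes _) _ = refl
𝟙-yes (no ¬p) p = ⊥-elim (¬p p)

module Expectation (B : ℕ) where

  mark : ℕ → Bool → (ℕ → Bool) → ℕ → Bool
  mark N β ω n = if ⌊ n ≟ N ⌋ then β else ω n

  -- The unnormalised expectation of h when every i < N is marked independently with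
  -- probability 1 / (1 + B); the total mass is (1 + B) ^ N.
  𝔼 : ℕ → ((ℕ → Bool) → ℕ) → ℕ
  𝔼 zero    h = h (λ _ → false)
  𝔼 (suc N) h = 𝔼 N (λ ω → h (mark N true ω) + B * h (mark N false ω))

  𝔼-cong : ∀ N {h g} → (∀ ω → h ω ≡ g ω) → 𝔼 N h ≡ 𝔼 N g
  𝔼-cong zero    e = e _
  𝔼-cong (suc N) e = 𝔼-cong N λ ω → cong₂ (λ a b → a + B * b) (e _) (e _)

  𝔼-mono : ∀ N {h g} → (∀ ω → h ω ≤ g ω) → 𝔼 N h ≤ 𝔼 N g
  𝔼-mono zero    e = e _
  𝔼-mono (suc N) e = 𝔼-mono N λ ω → +-mono-≤ (e _) (*-monoʳ-≤ B (e _))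

  𝔼-+ : ∀ N h g → 𝔼 N (λ ω → h ω + g ω) ≡ 𝔼 N h + 𝔼 N g
  𝔼-+ zero    h g = refl
  𝔼-+ (suc N) h g = trans
    (𝔼-cong N λ ω → solve 5 (λ a b c d B → a :+ b :+ B :* (c :+ d) := a :+ B :* c :+ (b :+ B :* d)) refl
      (h (mark N true ω)) (g (mark N true ω)) (h (mark N false ω)) (g (mark N false ω)) B)
    (𝔼-+ N _ _)

  𝔼-* : ∀ N c h → 𝔼 N (λ ω → c * h ω) ≡ c * 𝔼 N h
  𝔼-* zero    c h = refl
  𝔼-* (suc N) c h = trans
    (𝔼-cong N λ ω → solve 4 (λ c a b B → c :* a :+ B :* (c :* b) := c :* (a :+ B :* b)) refl
      c (h (mark N true ω)) (h (mark N false ω)) B)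
    (𝔼-* N c _)

  𝔼-1 : ∀ N → 𝔼 N (λ _ → 1) ≡ suc B ^ N
  𝔼-1 zero    = refl
  𝔼-1 (suc N) = trans (𝔼-cong N λ ω → trans (cong suc (*-identityʳ B)) (sym (*-identityʳ (suc B))))
    (trans (𝔼-* N (suc B) (λ _ → 1)) (cong (suc B *_) (𝔼-1 N)))

  -- An average of at least c is reached somewhere: the marks are fixed one at a time, never letting
  -- the conditional average fall below c.
  attained : ∀ N c h → c * suc B ^ N ≤ 𝔼 N h → ∃ λ ω → c ≤ h ω
  attained zero    c h c≤ = (λ _ → false) , ≤-trans (≤-reflexive (sym (*-identityʳ c))) c≤
  attained (suc N) c h c≤ with attained N (c * suc B) _ (≤-trans (≤-reflexive (*-assoc c (suc B) (suc B ^ N))) c≤)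
  ... | ω , le with c ≤? h (mark N true ω) | c ≤? h (mark N false ω)
  ...   | yes c≤h | _       = _ , c≤h
  ...   | no _    | yes c≤h = _ , c≤h
  ...   | no c≰₁  | no c≰₂  = ⊥-elim (<⇒≱ (+-mono-<-≤ (≰⇒> c≰₁) (*-monoʳ-≤ B (<⇒≤ (≰⇒> c≰₂))))
            (≤-trans (≤-reflexive (*-comm (suc B) c)) le))

  lead-mark : ∀ {N} β ω u → Decreasing N u → lead (mark N β ω) u ≡ lead ω u
  lead-mark         β ω []      _         = refl
  lead-mark {N} β ω (j ∷ u) (j<N , d) with j ≟ N
  ... | yes refl = ⊥-elim (<-irrefl refl j<N)
  ... | no  _    = cong (λ z → if ω j then 0 else suc z) (lead-mark β ω u (decreasing-weaken u (<⇒≤ j<N) d))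

  lead-marked : ∀ N ω u → lead (mark N true ω) (N ∷ u) ≡ 0
  lead-marked N ω u with N ≟ N
  ... | yes _  = refl
  ... | no n≢n = ⊥-elim (n≢n refl)

  lead-unmarked : ∀ N ω u → Decreasing N u → lead (mark N false ω) (N ∷ u) ≡ suc (lead ω u)
  lead-unmarked N ω u d with N ≟ N
  ... | yes _  = cong suc (lead-mark false ω u d)
  ... | no n≢n = ⊥-elim (n≢n refl)

  -- The first n entries are all unmarked with probability (B / (1 + B)) ^ n, denominators cleared.
  -- The mark at N either does not concern the list or decides its head.
  𝔼-lead : ∀ N n x → Decreasing N x → n ≤ length x →
           𝔼 N (λ ω → 𝟙 (n ≤? lead ω x)) * suc B ^ n ≡ suc B ^ N * B ^ n
  𝔼-lead N zero x d h = cong (_* 1) (trans (𝔼-cong N λ ω → 𝟙-yes (0 ≤? lead ω x) z≤n) (𝔼-1 N))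
  𝔼-lead zero    (suc n) (j ∷ x) (() , _) h
  𝔼-lead (suc N) (suc n) (j ∷ x) (j<N , d) (s≤s h) with m≤n⇒m<n∨m≡n (≤-pred j<N)
  ... | inj₁ j<N′ = begin
    𝔼 (suc N) (λ ω → 𝟙 (suc n ≤? lead ω (j ∷ x))) * suc B ^ suc n
      ≡⟨ cong (_* suc B ^ suc n) (𝔼-cong N λ ω → cong₂ (λ a b → 𝟙 (suc n ≤? a) + B * 𝟙 (suc n ≤? b))
            (lead-mark true ω (j ∷ x) (j<N′ , d)) (lead-mark false ω (j ∷ x) (j<N′ , d))) ⟩
    𝔼 N (λ ω → suc B * 𝟙 (suc n ≤? lead ω (j ∷ x))) * suc B ^ suc n
      ≡⟨ cong (_* suc B ^ suc n) (𝔼-* N (suc B) _) ⟩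
    suc B * 𝔼 N (λ ω → 𝟙 (suc n ≤? lead ω (j ∷ x))) * suc B ^ suc n
      ≡⟨ *-assoc (suc B) (𝔼 N (λ ω → 𝟙 (suc n ≤? lead ω (j ∷ x)))) (suc B ^ suc n) ⟩
    suc B * (𝔼 N (λ ω → 𝟙 (suc n ≤? lead ω (j ∷ x))) * suc B ^ suc n)
      ≡⟨ cong (suc B *_) (𝔼-lead N (suc n) (j ∷ x) (j<N′ , d) (s≤s h)) ⟩
    suc B * (suc B ^ N * B ^ suc n)
      ≡⟨ *-assoc (suc B) (suc B ^ N) (B ^ suc n) ⟨
    suc B ^ suc N * B ^ suc n ∎
    where open ≡-Reasoning
  ... | inj₂ refl = begin
    𝔼 (suc N) (λ ω → 𝟙 (suc n ≤? lead ω (N ∷ x))) * suc B ^ suc n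
      ≡⟨ cong (_* suc B ^ suc n) (𝔼-cong N λ ω → cong₂ _+_
           (𝟙-no (suc n ≤? lead (mark N true ω) (N ∷ x)) (λ le → case ≤-trans le (≤-reflexive (lead-marked N ω x)) of λ ()))
           (cong (B *_) (𝟙-cong (suc n ≤? lead (mark N false ω) (N ∷ x)) (n ≤? lead ω x)
             (λ le → ≤-pred (≤-trans le (≤-reflexive (lead-unmarked N ω x d))))
             (λ le → ≤-trans (s≤s le) (≤-reflexive (sym (lead-unmarked N ω x d))))))) ⟩
    𝔼 N (λ ω → B * 𝟙 (n ≤? lead ω x)) * suc B ^ suc n
      ≡⟨ cong (_* suc B ^ suc n) (𝔼-* N B _) ⟩
    B * 𝔼 N (λ ω → 𝟙 (n ≤? lead ω x)) * suc B ^ suc n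
      ≡⟨ solve 4 (λ b e m p → b :* e :* (m :* p) := m :* b :* (e :* p)) refl B (𝔼 N (λ ω → 𝟙 (n ≤? lead ω x))) (suc B) (suc B ^ n) ⟩
    suc B * B * (𝔼 N (λ ω → 𝟙 (n ≤? lead ω x)) * suc B ^ n)
      ≡⟨ cong (suc B * B *_) (𝔼-lead N n x d h) ⟩
    suc B * B * (suc B ^ N * B ^ n)
      ≡⟨ solve 4 (λ m b x y → m :* b :* (x :* y) := m :* x :* (b :* y)) refl (suc B) B (suc B ^ N) (B ^ n) ⟩
    suc B ^ suc N * B ^ suc n ∎
    where open ≡-Reasoning

-- Bernoulli inequalities and the choice of constants

-- This is (1 - 1/(1+B)) ^ n ≥ 1 - n/(1+B) with denominators cleared.
bernoulli : ∀ B n → suc B * suc B ^ n ≤ suc B * B ^ n + n * suc B ^ n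
bernoulli B zero    = ≤-reflexive (sym (+-identityʳ _))
bernoulli B (suc n) = begin
  suc B * (suc B * suc B ^ n)                          ≤⟨ *-monoʳ-≤ (suc B) (bernoulli B n) ⟩
  suc B * (suc B * B ^ n + n * suc B ^ n)              ≡⟨ solve 4 (λ B b n m → (con 1 :+ B) :* ((con 1 :+ B) :* b :+ n :* m)
                                                            := (con 1 :+ B) :* (B :* b) :+ ((con 1 :+ B) :* b :+ n :* ((con 1 :+ B) :* m))) refl B (B ^ n) n (suc B ^ n) ⟩
  suc B * B ^ suc n + (suc B * B ^ n + n * suc B ^ suc n) ≤⟨ +-monoʳ-≤ (suc B * B ^ suc n) (+-monoˡ-≤ _ (*-monoʳ-≤ (suc B) (^-monoˡ-≤ n (n≤1+n B)))) ⟩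
  suc B * B ^ suc n + suc n * suc B ^ suc n            ∎
  where open ≤-Reasoning

-- This is (1 + 1/B) ^ n ≥ 1 + n/B with denominators cleared.
bernoulli′ : ∀ B n → B ^ n * (B + n) ≤ B * suc B ^ n
bernoulli′ B zero    = ≤-reflexive (trans (*-identityˡ (B + 0)) (trans (+-identityʳ B) (sym (*-identityʳ B))))
bernoulli′ B (suc n) = begin
  B * B ^ n * (B + suc n)         ≤⟨ m≤m+n _ (n * B ^ n) ⟩
  B * B ^ n * (B + suc n) + n * B ^ n ≡⟨ solve 3 (λ B b n → B :* b :* (B :+ (con 1 :+ n)) :+ n :* b := (con 1 :+ B) :* (b :* (B :+ n))) refl B (B ^ n) n ⟩
  suc B * (B ^ n * (B + n))       ≤⟨ *-monoʳ-≤ (suc B) (bernoulli′ B n) ⟩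
  suc B * (B * suc B ^ n)         ≡⟨ solve 2 (λ B m → (con 1 :+ B) :* (B :* m) := B :* ((con 1 :+ B) :* m)) refl B (suc B ^ n) ⟩
  B * (suc B * suc B ^ n)         ∎
  where open ≤-Reasoning

module Density (k a : ℕ) .{{_ : NonZero k}} .{{_ : NonZero a}} .{{_ : NonZero (pred k)}} where

  -- `B` makes a mark among the first k - 1 entries unlikely, as n/(1+B) < 1/2a. `L` makes a window
  -- without marks unlikely, as B/(B+L) ≤ 1/2a. The summands n and 2 ensure n ≤ `L` and the form 2 +
  -- m of a window length.
  n B L : ℕ
  n = pred k
  B = 2 * a * n
  L = 2 + (2 * a * B + n)

  open Selection k L
  open Expectation B

  private
    instance
      B≢0 : NonZero B
      B≢0 = m*n≢0 (2 * a) n {{m*n≢0 2 a}}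

    tail-small : 2 * a * B ^ L ≤ suc B ^ L
    tail-small = *-cancelˡ-≤ B (begin
      B * (2 * a * B ^ L)   ≡⟨ solve 3 (λ B a p → B :* (a :* p) := p :* (a :* B)) refl B (2 * a) (B ^ L) ⟩
      B ^ L * (2 * a * B)   ≤⟨ *-monoʳ-≤ (B ^ L) (≤-trans (m≤m+n (2 * a * B) n) (≤-trans (m≤n+m (2 * a * B + n) 2) (m≤n+m L B))) ⟩
      B ^ L * (B + L)       ≤⟨ bernoulli′ B L ⟩
      B * suc B ^ L         ∎)
      where open ≤-Reasoning

  -- Both ways of being bad have probability at most 1 / 2a.
  good-mass : ∀ N x → Decreasing N x → length x ≡ L → ∀ c → c < a →
              c * suc B ^ N ≤ a * 𝔼 N (λ ω → 𝟙 (good? ω x))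
  good-mass N x d len c c<a = *-cancelˡ-≤ 2 (+-cancelʳ-≤ (2 * T) _ _ (begin
    2 * (c * T) + 2 * T          ≡⟨ solve 2 (λ c T → con 2 :* (c :* T) :+ con 2 :* T := con 2 :* (T :+ c :* T)) refl c T ⟩
    2 * (suc c * T)              ≤⟨ *-monoʳ-≤ 2 (*-monoˡ-≤ T c<a) ⟩
    2 * (a * T)                  ≡⟨ *-assoc 2 a T ⟨
    2 * a * T                    ≤⟨ prefix ⟩
    2 * a * e₁ + T               ≤⟨ +-monoˡ-≤ T (*-monoʳ-≤ (2 * a) e₁≤) ⟩
    2 * a * (g + e₂) + T         ≡⟨ cong (_+ T) (*-distribˡ-+ (2 * a) g e₂) ⟩
    2 * a * g + 2 * a * e₂ + T   ≤⟨ +-monoˡ-≤ T (+-monoʳ-≤ (2 * a * g) tail) ⟩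
    2 * a * g + T + T            ≡⟨ solve 3 (λ a g T → con 2 :* a :* g :+ T :+ T := con 2 :* (a :* g) :+ con 2 :* T) refl a g T ⟩
    2 * (a * g) + 2 * T          ∎))
    where
    open ≤-Reasoning
    T  = suc B ^ N
    g  = 𝔼 N (λ ω → 𝟙 (good? ω x))
    e₁ = 𝔼 N (λ ω → 𝟙 (n ≤? lead ω x))
    e₂ = 𝔼 N (λ ω → 𝟙 (L ≤? lead ω x))

    pointwise : ∀ ω → 𝟙 (n ≤? lead ω x) ≤ 𝟙 (good? ω x) + 𝟙 (L ≤? lead ω x)
    pointwise ω with n ≤? lead ω x | L ≤? lead ω x | lead ω x <? L
    ... | no _  | _     | _     = z≤n
    ... | yes _ | yes _ | yes _ = s≤s z≤n
    ... | yes _ | yes _ | no _  = s≤s z≤n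
    ... | yes _ | no _  | yes _ = s≤s z≤n
    ... | yes _ | no ≰  | no ≮  = ⊥-elim (≰ (≮⇒≥ ≮))

    e₁≤ : e₁ ≤ g + e₂
    e₁≤ = ≤-trans (𝔼-mono N pointwise) (≤-reflexive (𝔼-+ N _ _))

    n≤L : n ≤ L
    n≤L = ≤-trans (m≤n+m n (2 * a * B)) (m≤n+m _ 2)

    prefix : 2 * a * T ≤ 2 * a * e₁ + T
    prefix = *-cancelˡ-≤ (suc B) (*-cancelʳ-≤ _ _ (suc B ^ n) {{m^n≢0 (suc B) n}} (begin
      suc B * (2 * a * T) * suc B ^ n
        ≡⟨ solve 4 (λ M a T p → M :* (a :* T) :* p := a :* T :* (M :* p)) refl (suc B) (2 * a) T (suc B ^ n) ⟩
      2 * a * T * (suc B * suc B ^ n)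
        ≤⟨ *-monoʳ-≤ (2 * a * T) (bernoulli B n) ⟩
      2 * a * T * (suc B * B ^ n + n * suc B ^ n)
        ≡⟨ solve 6 (λ a T M b n p → a :* T :* (M :* b :+ n :* p) := M :* a :* (T :* b) :+ a :* n :* (T :* p)) refl (2 * a) T (suc B) (B ^ n) n (suc B ^ n) ⟩
      suc B * (2 * a) * (T * B ^ n) + B * (T * suc B ^ n)
        ≤⟨ +-monoʳ-≤ _ (*-monoˡ-≤ (T * suc B ^ n) (n≤1+n B)) ⟩
      suc B * (2 * a) * (T * B ^ n) + suc B * (T * suc B ^ n)
        ≡⟨ cong (λ z → suc B * (2 * a) * z + suc B * (T * suc B ^ n)) (𝔼-lead N n x d (≤-trans n≤L (≤-reflexive (sym len)))) ⟨
      suc B * (2 * a) * (e₁ * suc B ^ n) + suc B * (T * suc B ^ n)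
        ≡⟨ solve 5 (λ M a e p T → M :* a :* (e :* p) :+ M :* (T :* p) := M :* (a :* e :+ T) :* p) refl (suc B) (2 * a) e₁ (suc B ^ n) T ⟩
      suc B * (2 * a * e₁ + T) * suc B ^ n ∎))

    tail : 2 * a * e₂ ≤ T
    tail = *-cancelʳ-≤ _ _ (suc B ^ L) {{m^n≢0 (suc B) L}} (begin
      2 * a * e₂ * suc B ^ L      ≡⟨ *-assoc (2 * a) e₂ (suc B ^ L) ⟩
      2 * a * (e₂ * suc B ^ L)    ≡⟨ cong (2 * a *_) (𝔼-lead N L x d (≤-reflexive (sym len))) ⟩
      2 * a * (T * B ^ L)         ≡⟨ solve 3 (λ a T b → a :* (T :* b) := T :* (a :* b)) refl (2 * a) T (B ^ L) ⟩
      T * (2 * a * B ^ L)         ≤⟨ *-monoʳ-≤ T tail-small ⟩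
      T * suc B ^ L               ∎)

-- Assembling the set

length-filter-∷ : ∀ {A : Set} {P : A → Set} (P? : Decidable P) x xs →
                  length (filter P? (x ∷ xs)) ≡ 𝟙 (P? x) + length (filter P? xs)
length-filter-∷ P? x xs with P? x
... | yes _ = refl
... | no  _ = refl

sumBelow : ℕ → (ℕ → ℕ) → ℕ
sumBelow zero    h = 0
sumBelow (suc K) h = h K + sumBelow K h

sumBelow-cong : ∀ K {h g} → (∀ s → h s ≡ g s) → sumBelow K h ≡ sumBelow K g
sumBelow-cong zero    e = refl
sumBelow-cong (suc K) e = cong₂ _+_ (e K) (sumBelow-cong K e)

sumBelow-+ : ∀ K h g → sumBelow K (λ s → h s + g s) ≡ sumBelow K h + sumBelow K g
sumBelow-+ zero    h g = refl
sumBelow-+ (suc K) h g = trans (cong (h K + g K +_) (sumBelow-+ K h g))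
  (solve 4 (λ a b c d → a :+ b :+ (c :+ d) := a :+ c :+ (b :+ d)) refl (h K) (g K) (sumBelow K h) (sumBelow K g))

sumBelow-0 : ∀ K → sumBelow K (λ _ → 0) ≡ 0
sumBelow-0 zero    = refl
sumBelow-0 (suc K) = sumBelow-0 K

sumBelow-max : ∀ K .{{_ : NonZero K}} h → ∃ λ s → s < K × sumBelow K h ≤ K * h s
sumBelow-max (suc zero)    h = 0 , s≤s z≤n , ≤-refl
sumBelow-max (suc (suc K)) h with sumBelow-max (suc K) h
... | s , s<K , le with h (suc K) ≤? h s
...   | yes le′ = s , m≤n⇒m≤1+n s<K , +-mono-≤ le′ le
...   | no  gt  = suc K , ≤-refl , +-monoʳ-≤ (h (suc K)) (≤-trans le (*-monoʳ-≤ (suc K) (<⇒≤ (≰⇒> gt))))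

-- Exactly one term vanishes once K has passed ρ; the case K ≤ ρ carries the induction up to that
-- point.
sumBelow-avoid : ∀ K ρ → (K ≤ ρ → sumBelow K (λ s → 𝟙 (¬? (ρ ≟ s))) ≡ K) ×
                         (ρ < K → sumBelow K (λ s → 𝟙 (¬? (ρ ≟ s))) + 1 ≡ K)
sumBelow-avoid zero    ρ = (λ _ → refl) , λ ()
sumBelow-avoid (suc K) ρ with sumBelow-avoid K ρ
... | above , below = above′ , below′
  where
  above′ : suc K ≤ ρ → 𝟙 (¬? (ρ ≟ K)) + sumBelow K (λ s → 𝟙 (¬? (ρ ≟ s))) ≡ suc K
  above′ K<ρ = cong₂ _+_ (𝟙-yes (¬? (ρ ≟ K)) (>⇒≢ K<ρ)) (above (<⇒≤ K<ρ))
  below′ : ρ < suc K → 𝟙 (¬? (ρ ≟ K)) + sumBelow K (λ s → 𝟙 (¬? (ρ ≟ s))) + 1 ≡ suc K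
  below′ ρ<1+K with m≤n⇒m<n∨m≡n (≤-pred ρ<1+K)
  ... | inj₁ ρ<K  = trans (cong (λ z → z + sumBelow K (λ s → 𝟙 (¬? (ρ ≟ s))) + 1) (𝟙-yes (¬? (ρ ≟ K)) (<⇒≢ ρ<K))) (cong suc (below ρ<K))
  ... | inj₂ refl = trans (cong (λ z → z + sumBelow K (λ s → 𝟙 (¬? (ρ ≟ s))) + 1) (𝟙-no (¬? (ρ ≟ ρ)) λ h → h refl))
                      (trans (cong (_+ 1) (above ≤-refl)) (+-comm K 1))

module Choice (k q : ℕ) .{{_ : NonZero k}} .{{_ : NonZero (pred k * q)}} .{{_ : NonZero (pred k)}} where

  open Density k (pred k * q)
  open Selection k L
  open Expectation B

  module _ (label : ℕ → List ℕ) where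

    selections : ∀ ω y → sumBelow k (λ s → 𝟙 (selected? ω s (label y))) + 𝟙 (good? ω (label y)) ≡ k * 𝟙 (good? ω (label y))
    selections ω y = cases (good? ω (label y))
      where
      ρ = lead ω (label y) % k
      -- `selected?` is assembled from `good?`, so abstracting this one decision evaluates both
      -- sides.
      cases : (g? : Dec (Good ω (label y))) →
              sumBelow k (λ s → 𝟙 (g? ×-dec ¬? (ρ ≟ s))) + 𝟙 g? ≡ k * 𝟙 g?
      cases (no ¬g) = trans (cong (_+ 0) (trans (sumBelow-cong k λ s → 𝟙-no (no ¬g ×-dec ¬? (ρ ≟ s)) (¬g ∘ proj₁)) (sumBelow-0 k))) (sym (*-zeroʳ k))
      cases (yes g) = trans (cong (_+ 1) (sumBelow-cong k λ s → 𝟙-cong (yes g ×-dec ¬? (ρ ≟ s)) (¬? (ρ ≟ s)) proj₂ (g ,_)))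
        (trans (proj₂ (sumBelow-avoid k ρ) (m%n<n (lead ω (label y)) k)) (sym (*-identityʳ k)))

    #good : (ℕ → Bool) → List ℕ → ℕ
    #good ω Y = length (filter (good? ω ∘ label) Y)

    #selected : (ℕ → Bool) → ℕ → List ℕ → ℕ
    #selected ω s Y = length (filter (selected? ω s ∘ label) Y)

    -- Double counting: each good element is selected for all residues but one.
    all-selections : ∀ ω Y → sumBelow k (λ s → #selected ω s Y) + #good ω Y ≡ k * #good ω Y
    all-selections ω []      = trans (cong (_+ 0) (sumBelow-0 k)) (sym (*-zeroʳ k))
    all-selections ω (y ∷ Y) = begin
      sumBelow k (λ s → #selected ω s (y ∷ Y)) + #good ω (y ∷ Y)
        ≡⟨ cong₂ _+_ (trans (sumBelow-cong k λ s → length-filter-∷ (selected? ω s ∘ label) y Y) (sumBelow-+ k _ _))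
                     (length-filter-∷ (good? ω ∘ label) y Y) ⟩
      σ₁ + σ₂ + (g₁ + g₂)
        ≡⟨ solve 4 (λ a b c d → a :+ b :+ (c :+ d) := a :+ c :+ (b :+ d)) refl σ₁ σ₂ g₁ g₂ ⟩
      (σ₁ + g₁) + (σ₂ + g₂)
        ≡⟨ cong₂ _+_ (selections ω y) (all-selections ω Y) ⟩
      k * g₁ + k * g₂
        ≡⟨ *-distribˡ-+ k g₁ g₂ ⟨
      k * (g₁ + g₂)
        ≡⟨ cong (k *_) (length-filter-∷ (good? ω ∘ label) y Y) ⟨
      k * #good ω (y ∷ Y) ∎
      where
      open ≡-Reasoning
      σ₁ = sumBelow k (λ s → 𝟙 (selected? ω s (label y)))
      σ₂ = sumBelow k (λ s → #selected ω s Y)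
      g₁ = 𝟙 (good? ω (label y))
      g₂ = #good ω Y

    module _ (N c : ℕ) (c<a : c < pred k * q) where

      good-total : ∀ Y → (∀ {y} → y ∈ Y → Decreasing N (label y) × length (label y) ≡ L) →
                   c * length Y * suc B ^ N ≤ pred k * q * 𝔼 N (λ ω → #good ω Y)
      good-total []      h = ≤-trans (≤-reflexive (cong (_* suc B ^ N) (*-zeroʳ c))) z≤n
      good-total (y ∷ Y) h = begin
        c * suc (length Y) * suc B ^ N
          ≡⟨ solve 3 (λ c l T → c :* (con 1 :+ l) :* T := c :* T :+ c :* l :* T) refl c (length Y) (suc B ^ N) ⟩
        c * suc B ^ N + c * length Y * suc B ^ N
          ≤⟨ +-mono-≤ (good-mass N (label y) (proj₁ (h (here refl))) (proj₂ (h (here refl))) c c<a) (good-total Y (h ∘ there)) ⟩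
        pred k * q * 𝔼 N (λ ω → 𝟙 (good? ω (label y))) + pred k * q * 𝔼 N (λ ω → #good ω Y)
          ≡⟨ *-distribˡ-+ (pred k * q) _ _ ⟨
        pred k * q * (𝔼 N (λ ω → 𝟙 (good? ω (label y))) + 𝔼 N (λ ω → #good ω Y))
          ≡⟨ cong (pred k * q *_) (trans (sym (𝔼-+ N (λ ω → 𝟙 (good? ω (label y))) (λ ω → #good ω Y)))
               (𝔼-cong N λ ω → sym (length-filter-∷ (good? ω ∘ label) y Y))) ⟩
        pred k * q * 𝔼 N (λ ω → #good ω (y ∷ Y)) ∎
        where open ≤-Reasoning

    -- Some marking makes at least the fraction kp / ((k-1)q) of Y good, and the best residue class
    -- to discard leaves at least (k-1)/k of these. The product is p/q.
    choose : ∀ N p → k * p < pred k * q → ∀ Y → (∀ {y} → y ∈ Y → Decreasing N (label y) × length (label y) ≡ L) →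
             ∃ λ ω → ∃ λ s → s < k × p * length Y ≤ q * #selected ω s Y
    choose N p kp<a Y h
      with attained N (k * p * length Y) (λ ω → pred k * q * #good ω Y)
             (≤-trans (good-total N (k * p) kp<a Y h) (≤-reflexive (sym (𝔼-* N (pred k * q) (λ ω → #good ω Y)))))
    ... | ω , many with sumBelow-max k (λ s → #selected ω s Y)
    ... | s , s<k , le = ω , s , s<k , *-cancelˡ-≤ k (begin
      k * (p * length Y)          ≡⟨ *-assoc k p (length Y) ⟨
      k * p * length Y            ≤⟨ many ⟩
      pred k * q * #good ω Y      ≡⟨ solve 3 (λ k q g → k :* q :* g := q :* (k :* g)) refl (pred k) q (#good ω Y) ⟩
      q * (pred k * #good ω Y)    ≤⟨ *-monoʳ-≤ q (+-cancelʳ-≤ (#good ω Y) _ _ (begin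
          pred k * #good ω Y + #good ω Y                        ≡⟨ +-comm (pred k * #good ω Y) (#good ω Y) ⟩
          suc (pred k) * #good ω Y                              ≡⟨ cong (_* #good ω Y) (suc-pred k) ⟩
          k * #good ω Y                                         ≡⟨ all-selections ω Y ⟨
          sumBelow k (λ s → #selected ω s Y) + #good ω Y        ≤⟨ +-monoˡ-≤ (#good ω Y) le ⟩
          k * #selected ω s Y + #good ω Y                       ∎)) ⟩
      q * (k * #selected ω s Y)   ≡⟨ solve 3 (λ k q g → q :* (k :* g) := k :* (q :* g)) refl k q (#selected ω s Y) ⟩
      k * (q * #selected ω s Y)   ∎)
      where open ≤-Reasoning

injective⇒surjective : ∀ k (x : ℕ → ℕ) → (∀ {j} → j < k → x j < k) →
  (∀ {i j} → i < k → j < k → x i ≡ x j → i ≡ j) → ∀ {i} → i < k → ∃ λ j → j < k × x j ≡ i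
injective⇒surjective (suc k) x bound inj {i} i<k with any? (λ (j : Fin (suc k)) → x (toℕ j) ≟ i)
... | yes (j , e) = toℕ j , toℕ<n j , e
... | no  missed  = ⊥-elim collision
  where
  value : Fin (suc k) → Fin (suc k)
  value j = fromℕ< (bound (toℕ<n j))
  value-toℕ : ∀ j → toℕ (value j) ≡ x (toℕ j)
  value-toℕ j = toℕ-fromℕ< (bound (toℕ<n j))
  avoids : ∀ j → fromℕ< i<k ≢ value j
  avoids j e = missed (j , trans (sym (value-toℕ j)) (trans (cong toℕ (sym e)) (toℕ-fromℕ< i<k)))
  collision : ⊥
  collision with pigeonhole (n<1+n k) (λ j → punchOut (avoids j))
  ... | j , j′ , j<j′ , e = <-irrefl (inj (toℕ<n j) (toℕ<n j′)
      (trans (sym (value-toℕ j)) (trans (cong toℕ (punchOut-injective (avoids j) (avoids j′) e)) (value-toℕ j′)))) j<j′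

-- Finite gadgets for r colours

Sparse : (k p q : ℕ) → List ℕ → Set
Sparse k p q S = ∀ Y → Unique Y → (∀ {n} → n ∈ Y → n ∈ S) →
  ∃ λ Z → Z ⊆L Y × p * length Y ≤ q * length Z × APFree k Z

arithmetic : ∀ {k} a d → IsAP k (λ i → a + i * d)
arithmetic a d j _ = solve 3 (λ a j d → a :+ j :* d :+ (a :+ (con 2 :+ j) :* d) := a :+ (con 1 :+ j) :* d :+ (a :+ (con 1 :+ j) :* d)) refl a j d

arithmetic-nonconstant : ∀ a {d} → 0 < d → a + 0 * d ≢ a + 1 * d
arithmetic-nonconstant a {d} 0<d e = <⇒≢ 0<d (trans (+-cancelˡ-≡ a 0 (1 * d) e) (+-identityʳ d))

module Gadget (k : ℕ) (3≤k : 3 ≤ k) (p q : ℕ) (kp<a : k * p < pred k * q) where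

  private
    0<k : 0 < k
    0<k = ≤-trans (s≤s z≤n) 3≤k

    instance
      k≢0 : NonZero k
      k≢0 = >-nonZero 0<k
      a≢0 : NonZero (pred k * q)
      a≢0 = >-nonZero (≤-<-trans z≤n kp<a)
      k-1≢0 : NonZero (pred k)
      k-1≢0 = >-nonZero (≤-trans (s≤s z≤n) (pred-mono-≤ 3≤k))

  open Density k (pred k * q)
  open Selection k L
  open Choice k q

  -- Rather than naming the windows of a sequence, this keeps the two properties used of them:
  -- distinctness, and that no selection takes all k vertices. Both survive permutation.
  Edge : (ℕ → List ℕ) → Set
  Edge y = (∀ {i j} → i < k → j < k → y i ≡ y j → i ≡ j) ×
           (∀ ω s → s < k → ∃ λ j → j < k × ¬ Selected ω s (y j))

  edge-resp : ∀ {y y′} → (∀ j → j < k → y j ≡ y′ j) → Edge y → Edge y′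
  edge-resp e (inj , hit) =
    (λ i<k j<k eq → inj i<k j<k (trans (e _ i<k) (trans eq (sym (e _ j<k))))) ,
    (λ ω s s<k → let (j , j<k , ¬sel) = hit ω s s<k in j , j<k , subst (¬_ ∘ Selected ω s) (e j j<k) ¬sel)

  edge-reindex : ∀ {y} x → (∀ {j} → j < k → x j < k) → (∀ {i j} → i < k → j < k → x i ≡ x j → i ≡ j) → Edge y → Edge (y ∘ x)
  edge-reindex {y} x bound x-inj (inj , hit) =
    (λ i<k j<k eq → x-inj i<k j<k (inj (bound i<k) (bound j<k) eq)) ,
    λ ω s s<k → let (j , j<k , ¬sel) = hit ω s s<k
                    (i , i<k , xi≡j) = injective⇒surjective k x bound x-inj j<k
                in i , i<k , subst (λ z → ¬ Selected ω s (y z)) (sym xi≡j) ¬sel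

  module _ (r : ℕ) where

    private
      -- Makes 2 + m equal to `L`.
      m = 2 * (pred k * q) * B + pred k
      N = proj₁ (window-ramsey m k r)

    Vertex : List ℕ → Set
    Vertex u = Decreasing N u × length u ≡ L

    open Partite k 3≤k (≡-dec _≟_) Edge proj₁ edge-resp edge-reindex Vertex
    open System

    private
      Us = decreasing-lists N (k + suc m)

      window-edge : ∀ {U} → U ∈ Us → Edge (window L U) × (∀ {j} → j < k → Vertex (window L U j))
      window-edge {U} U∈ with decreasing-lists⁻ (k + suc m) U∈
      ... | dec , len = (window-inj , windows-hit U) , window-vertex
        where
        below : ∀ {j} → j < k → j < length U
        below j<k = ≤-trans j<k (≤-trans (m≤m+n k (suc m)) (≤-reflexive (sym len)))
        window-inj : ∀ {i j} → i < k → j < k → window L U i ≡ window L U j → i ≡ j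
        window-inj i<k j<k = window-injective (suc m) U dec (below i<k) (below j<k)
        window-vertex : ∀ {j} → j < k → Vertex (window L U j)
        window-vertex {j} j<k = decreasing-take L (drop j U) (decreasing-drop j U dec) ,
          trans (length-take L (drop j U)) (m≤n⇒m⊓n≡m (begin
            suc (suc m)            ≤⟨ m≤n+m (suc (suc m)) (k ∸ suc j) ⟩
            k ∸ suc j + suc (suc m) ≡⟨ +-suc (k ∸ suc j) (suc m) ⟩
            suc (k ∸ suc j) + suc m ≡⟨ cong (_+ suc m) (sym (+-∸-assoc 1 j<k)) ⟩
            k ∸ j + suc m          ≡⟨ +-∸-comm (suc m) (<⇒≤ j<k) ⟨
            k + suc m ∸ j          ≡⟨ cong (_∸ j) len ⟨
            length U ∸ j           ≡⟨ length-drop j U ⟨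
            length (drop j U)      ∎))
          where open ≤-Reasoning

      abstract
        base : Σ System λ P → ∀ {e} → e ∈ map (window L) Us → ∃ λ o → ∀ {j} → j < k → (o + j , e j) ∈ points P
        base = disjoint-edges (map (window L) Us) λ e∈ →
          let (U , U∈ , e≡) = ∈-map⁻ (window L) e∈ in
          subst (λ e → Edge e × (∀ {j} → j < k → Vertex (e j))) (sym e≡) (window-edge U∈)

      P₀ = proj₁ base

      abstract
        final : ∃ λ P → Contains P (map proj₂ (points P₀)) r P₀
        final = contains-all (map proj₂ (points P₀)) r P₀

      P = proj₁ final

    positions : List ℕ
    positions = map proj₁ (points P)

    -- Some copy of the base system is coloured through its labels. That colouring of windows has k
    -- successive ones of equal colour, and the copy of their edge is a progression with difference
    -- A.
    monochromatic : (c : ℕ → Fin r) → ∃ λ a → ∃ λ d → ∃ λ γ → 0 < d ×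
      (∀ i → i < k → a + i * d ∈ positions × c (a + i * d) ≡ γ)
    monochromatic c with proj₂ final c
    ... | A , C , κ , A>0 , copy , mono with proj₂ (window-ramsey m k r) κ
    ... | U , γ , dec , len , same with proj₂ base (∈-map⁺ (window L) (subst (λ n → U ∈ decreasing-lists N n) len (decreasing-lists⁺ U dec)))
    ... | o , o∈ = A * o + C , A , γ , A>0 , λ i i<k →
      subst (_∈ positions) (affine i) (∈-map⁺ proj₁ (copy (o∈ i<k))) ,
      trans (cong c (sym (affine i))) (trans (mono (∈-map⁺ proj₂ (o∈ i<k)) (o∈ i<k)) (same i i<k))
      where
      affine : ∀ i → A * (o + i) + C ≡ A * o + C + i * A
      affine i = solve 4 (λ A o i C → A :* (o :+ i) :+ C := A :* o :+ C :+ i :* A) refl A o i C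

    private
      label : ℕ → List ℕ
      label y with Any.any? (λ pt → proj₁ pt ≟ y) (points P)
      ... | yes y∈ = proj₂ (proj₁ (find y∈))
      ... | no  _  = []

      label∈ : ∀ {y} → y ∈ positions → (y , label y) ∈ points P
      label∈ {y} y∈ with Any.any? (λ pt → proj₁ pt ≟ y) (points P)
      ... | yes w = subst (λ z → (z , proj₂ (proj₁ (find w))) ∈ points P) (proj₂ (proj₂ (find w))) (proj₁ (proj₂ (find w)))
      ... | no  ¬w = let (pt , pt∈ , e) = ∈-map⁻ proj₁ y∈ in ⊥-elim (¬w (Any.map (λ { refl → sym e }) pt∈))

    -- Elements with selected labels are kept. A progression among them, moved back by `o`, would
    -- have labels forming an edge, and every edge has an unselected vertex.
    sparse : ∀ o → Sparse k p q (map (o +_) positions)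
    sparse o Y Y! Y⊆ = let (ω , s , s<k , dense) = choose (λ y → label (y ∸ o)) N p kp<a Y
                                (λ y∈ → vertices P (label∈ (unshift (Y⊆ y∈)))) in
      filter (sel? ω s) Y , (Unique.filter⁺ (sel? ω s) Y! , λ n n∈ → proj₁ (∈-filter⁻ (sel? ω s) n∈)) , dense , free ω s s<k
      where
      unshift : ∀ {y} → y ∈ map (o +_) positions → y ∸ o ∈ positions
      unshift y∈ = let (z , z∈ , e) = ∈-map⁻ (o +_) y∈ in subst (_∈ positions) (sym (trans (cong (_∸ o) e) (m+n∸m≡n o z))) z∈

      sel? : ∀ ω s → Decidable (λ y → Selected ω s (label (y ∸ o)))
      sel? ω s y = selected? ω s (label (y ∸ o))

      free : ∀ ω s → s < k → APFree k (filter (sel? ω s) Y)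
      free ω s s<k (a , d , 0<d , x∈) = let (j , j<k , ¬sel) = proj₂ edge ω s s<k in ¬sel (proj₂ (∈-filter⁻ (sel? ω s) {xs = Y} (x∈ j j<k)))
        where
        x : ℕ → ℕ
        x i = a + i * d
        origin : ∀ {i} → i < k → x i ∸ o ∈ positions × o + (x i ∸ o) ≡ x i
        origin i<k = let (z , z∈ , e) = ∈-map⁻ (o +_) (Y⊆ (proj₁ (∈-filter⁻ (sel? ω s) {xs = Y} (x∈ _ i<k))))
                         xo≡z = trans (cong (_∸ o) e) (m+n∸m≡n o z)
                     in subst (_∈ positions) (sym xo≡z) z∈ , trans (cong (o +_) xo≡z) (sym e)
        ap : IsAP k (λ i → x i ∸ o)
        ap j h = +-cancelˡ-≡ (o + o) _ _ (begin
          o + o + (x j ∸ o + (x (2 + j) ∸ o))                ≡⟨ regroup (x j ∸ o) _ ⟩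
          o + (x j ∸ o) + (o + (x (2 + j) ∸ o))              ≡⟨ cong₂ _+_ (proj₂ (origin (<-trans (n<1+n _) (<-trans (n<1+n _) h)))) (proj₂ (origin h)) ⟩
          x j + x (2 + j)                                    ≡⟨ arithmetic {k} a d j h ⟩
          x (1 + j) + x (1 + j)                              ≡⟨ cong₂ _+_ (proj₂ (origin (<-trans (n<1+n _) h))) (proj₂ (origin (<-trans (n<1+n _) h))) ⟨
          o + (x (1 + j) ∸ o) + (o + (x (1 + j) ∸ o))        ≡⟨ regroup (x (1 + j) ∸ o) _ ⟨
          o + o + (x (1 + j) ∸ o + (x (1 + j) ∸ o))          ∎)
          where
          open ≡-Reasoning
          regroup : ∀ y z → o + o + (y + z) ≡ o + y + (o + z)
          regroup y z = solve 3 (λ o y z → o :+ o :+ (y :+ z) := o :+ y :+ (o :+ z)) refl o y z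
        1<k : 1 < k
        1<k = ≤-trans (s≤s (s≤s z≤n)) 3≤k
        edge : Edge (λ i → label (x i ∸ o))
        edge = progressions P (λ i → x i ∸ o) (λ i → label (x i ∸ o)) (λ i i<k → label∈ (proj₁ (origin i<k))) ap
          (λ e → arithmetic-nonconstant a 0<d
            (trans (sym (proj₂ (origin 0<k))) (trans (cong (o +_) e) (proj₂ (origin 1<k)))))

-- The union of translated gadgets

length-partition : ∀ {A : Set} {P : A → Set} (P? : Decidable P) xs →
                   length xs ≡ length (filter P? xs) + length (filter (¬? ∘ P?) xs)
length-partition P? []       = refl
length-partition P? (x ∷ xs) with P? x
... | yes _ = cong suc (length-partition P? xs)
... | no  _ = trans (cong suc (length-partition P? xs)) (sym (+-suc _ _))

-- Y is cut at `o` and each part thinned separately. Densities add up, and no progression meets both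
-- parts.
sparse-union : ∀ {k p q} → 3 ≤ k → ∀ {T o w} → w + (T + T) < o → ∀ {xs ys} →
  (∀ {n} → n ∈ xs → n ≤ T) → (∀ {n} → n ∈ ys → o ≤ n × n ≤ o + w) →
  Sparse k p q xs → Sparse k p q ys → Sparse k p q (xs ++ ys)
sparse-union {k} {p} {q} 3≤k {T} {o} {w} far {xs} {ys} low high sx sy Y Y! Y⊆
  with sx Y₁ (Unique.filter⁺ (_<? o) Y!) Y₁⊆ | sy Y₂ (Unique.filter⁺ (¬? ∘ (_<? o)) Y!) Y₂⊆
  where
  Y₁ = filter (_<? o) Y
  Y₂ = filter (¬? ∘ (_<? o)) Y
  Y₁⊆ : ∀ {n} → n ∈ Y₁ → n ∈ xs
  Y₁⊆ n∈ with ∈-filter⁻ (_<? o) {xs = Y} n∈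
  ... | n∈Y , n<o with ∈-++⁻ xs (Y⊆ n∈Y)
  ...   | inj₁ n∈xs = n∈xs
  ...   | inj₂ n∈ys = ⊥-elim (<⇒≱ n<o (proj₁ (high n∈ys)))
  Y₂⊆ : ∀ {n} → n ∈ Y₂ → n ∈ ys
  Y₂⊆ n∈ with ∈-filter⁻ (¬? ∘ (_<? o)) {xs = Y} n∈
  ... | n∈Y , n≮o with ∈-++⁻ xs (Y⊆ n∈Y)
  ...   | inj₁ n∈xs = ⊥-elim (n≮o (≤-<-trans (≤-trans (low n∈xs) (≤-trans (m≤m+n T T) (m≤n+m (T + T) w))) far))
  ...   | inj₂ n∈ys = n∈ys
... | Z₁ , (Z₁! , Z₁⊆) , d₁ , free₁ | Z₂ , (Z₂! , Z₂⊆) , d₂ , free₂ =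
  Z₁ ++ Z₂ , (Unique.++⁺ Z₁! Z₂! disjoint , λ n n∈ → [ (λ m → proj₁ (in₁ m)) , (λ m → proj₁ (in₂ m)) ] (∈-++⁻ Z₁ n∈)) , dense , free
  where
  Y₁ = filter (_<? o) Y
  Y₂ = filter (¬? ∘ (_<? o)) Y
  in₁ : ∀ {n} → n ∈ Z₁ → n ∈ Y × n < o
  in₁ m = ∈-filter⁻ (_<? o) {xs = Y} (Z₁⊆ _ m)
  in₂ : ∀ {n} → n ∈ Z₂ → n ∈ Y × ¬ (n < o)
  in₂ m = ∈-filter⁻ (¬? ∘ (_<? o)) {xs = Y} (Z₂⊆ _ m)
  disjoint : ∀ {n} → ¬ (n ∈ Z₁ × n ∈ Z₂)
  disjoint (m₁ , m₂) = proj₂ (in₂ m₂) (proj₂ (in₁ m₁))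
  low′ : ∀ {n} → n ∈ Z₁ → n ≤ T
  low′ m with ∈-++⁻ xs (Y⊆ (proj₁ (in₁ m)))
  ... | inj₁ n∈xs = low n∈xs
  ... | inj₂ n∈ys = ⊥-elim (<⇒≱ (proj₂ (in₁ m)) (proj₁ (high n∈ys)))
  high′ : ∀ {n} → n ∈ Z₂ → o ≤ n × n ≤ o + w
  high′ m with ∈-++⁻ xs (Y⊆ (proj₁ (in₂ m)))
  ... | inj₂ n∈ys = high n∈ys
  ... | inj₁ n∈xs = ⊥-elim (proj₂ (in₂ m) (≤-<-trans (≤-trans (low n∈xs) (≤-trans (m≤m+n T T) (m≤n+m (T + T) w))) far))
  dense : p * length Y ≤ q * length (Z₁ ++ Z₂)
  dense = begin
    p * length Y                       ≡⟨ cong (p *_) (length-partition (_<? o) Y) ⟩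
    p * (length Y₁ + length Y₂)        ≡⟨ *-distribˡ-+ p (length Y₁) (length Y₂) ⟩
    p * length Y₁ + p * length Y₂      ≤⟨ +-mono-≤ d₁ d₂ ⟩
    q * length Z₁ + q * length Z₂      ≡⟨ *-distribˡ-+ q (length Z₁) (length Z₂) ⟨
    q * (length Z₁ + length Z₂)        ≡⟨ cong (q *_) (length-++ Z₁) ⟨
    q * length (Z₁ ++ Z₂)              ∎
    where open ≤-Reasoning
  free : APFree k (Z₁ ++ Z₂)
  free (a , d , 0<d , x∈) with split-progression 3≤k id far low′ high′ (λ i → a + i * d) (λ {i} → x∈ i) (arithmetic a d)
  ... | inj₁ in-Z₁ = free₁ (a , d , 0<d , λ i → in-Z₁)
  ... | inj₂ in-Z₂ = free₂ (a , d , 0<d , λ i → in-Z₂)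

module Union (k : ℕ) (3≤k : 3 ≤ k) (p q : ℕ) (positions : ℕ → List ℕ)
  (monochromatic : ∀ r (c : ℕ → Fin r) → ∃ λ a → ∃ λ d → ∃ λ γ → 0 < d ×
    (∀ i → i < k → a + i * d ∈ positions r × c (a + i * d) ≡ γ))
  (sparse : ∀ r o → Sparse k p q (map (o +_) (positions r))) where

  mutual
    stage : ℕ → List ℕ
    stage zero    = []
    stage (suc r) = stage r ++ map (offset r +_) (positions r)

    -- Sums serve as upper bounds for list elements, giving the separation that `sparse-union`
    -- requires; the summand r also pushes the new piece above r.
    offset : ℕ → ℕ
    offset r = suc (r + (sum (positions r) + (sum (stage r) + sum (stage r))))

  private
    high : ∀ r {n} → n ∈ map (offset r +_) (positions r) → offset r ≤ n × n ≤ offset r + sum (positions r)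
    high r n∈ with ∈-map⁻ (offset r +_) n∈
    ... | z , z∈ , refl = m≤m+n (offset r) z , +-monoʳ-≤ (offset r) (∈⇒≤sum z∈)

  stage-sparse : ∀ r → Sparse k p q (stage r)
  stage-sparse zero    [] Y! Y⊆ = [] , (Y! , λ _ ()) , ≤-reflexive (trans (*-zeroʳ p) (sym (*-zeroʳ q))) ,
    λ (a , d , _ , x∈) → case x∈ 0 (≤-trans (s≤s z≤n) 3≤k) of λ ()
  stage-sparse zero    (y ∷ Y) Y! Y⊆ = case Y⊆ (here refl) of λ ()
  stage-sparse (suc r) = sparse-union {p = p} {q} 3≤k {w = sum (positions r)} (s≤s (m≤n+m _ r)) ∈⇒≤sum (high r) (stage-sparse r) (sparse r (offset r))

  stage-mono : ∀ {r r′} → r ≤ r′ → ∀ {n} → n ∈ stage r → n ∈ stage r′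
  stage-mono {r} r≤r′ {n} n∈ with m≤n⇒∃[o]m+o≡n r≤r′
  ... | e , refl = grow e
    where
    grow : ∀ e → n ∈ stage (r + e)
    grow zero    = subst (λ z → n ∈ stage z) (sym (+-identityʳ r)) n∈
    grow (suc e) = subst (λ z → n ∈ stage z) (sym (+-suc r e)) (∈-++⁺ˡ (grow e))

  stage-own : ∀ r {n} → n ∈ stage r → n ∈ stage n
  stage-own (suc r) n∈ with ∈-++⁻ (stage r) n∈
  ... | inj₁ old = stage-own r old
  ... | inj₂ new = stage-mono (≤-trans (s≤s (m≤m+n r _)) (proj₁ (high r new))) n∈

  -- Stage suc r only adds numbers above r, so membership of n is settled at stage n.
  X : NatSet
  X n = ⌊ _∈?_ _≟_ n (stage n) ⌋

  X⁺ : ∀ r {n} → n ∈ stage r → n ∈S X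
  X⁺ r n∈ = fromWitness (stage-own r n∈)

  module _ {r : ℕ} (1≤r : 1 ≤ r) (c : Colouring X r) where

    extend : ℕ → Fin r
    extend n with T? (X n)
    ... | yes n∈ = c n n∈
    -- Numbers outside `X` receive an arbitrary colour.
    ... | no  _  = fromℕ< 1≤r

    extend-agrees : ∀ {n} (n∈ : n ∈S X) → extend n ≡ c n n∈
    extend-agrees {n} n∈ with T? (X n)
    ... | yes n∈′ = cong (c n) (T-irrelevant n∈′ n∈)
    ... | no  n∉  = ⊥-elim (n∉ n∈)

  X-ramsey : (r : ℕ) → 1 ≤ r → (c : Colouring X r) → HasMonoAP X r c k
  X-ramsey r 1≤r c with monochromatic r (extend 1≤r c ∘ (offset r +_))
  ... | a , d , γ , 0<d , h = offset r + a , d , γ , 0<d , λ i i<k →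
    subst (λ n → Σ (n ∈S X) λ n∈ → c n n∈ ≡ γ) (sym (+-assoc (offset r) a (i * d)))
      (let n∈ = X⁺ (suc r) (∈-++⁺ʳ (stage r) (∈-map⁺ (offset r +_) (proj₁ (h i i<k))))
       in n∈ , trans (sym (extend-agrees 1≤r c n∈)) (proj₂ (h i i<k)))

  -- All elements of Y are at most `sum Y`, so Y lies within one finite stage.
  X-sparse : (Y : List ℕ) → FinSubsetOf X Y → Σ (List ℕ) λ Z → (Z ⊆L Y) × (p * length Y ≤ q * length Z) × APFree k Z
  X-sparse Y (Y! , Y⊆) = stage-sparse (sum Y) Y Y! λ {n} n∈ → stage-mono (∈⇒≤sum n∈) (toWitness (Y⊆ n n∈))

-- Rational densities suffice, since between a real μ below (k-1)/k and that bound there is a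
-- rational p/q, and the estimate for p/q implies the one for μ.
theorem1p4 : (k : ℕ) → 3 ≤ k →
    -- μ = p / q, a rational with 0 < μ < (k-1)/k
    (p q : ℕ) → 0 < q → 0 < p → k * p < (k ∸ 1) * q →
    Σ NatSet λ X →
    ((r : ℕ) → 1 ≤ r → (c : Colouring X r) → HasMonoAP X r c k)
    ×
    ((Y : List ℕ) → FinSubsetOf X Y →
    Σ (List ℕ) λ Z → (Z ⊆L Y) × (p * length Y ≤ q * length Z) × APFree k Z)
theorem1p4 k 3≤k p q _ _ kp<a = X , X-ramsey , X-sparse
  where
  open Gadget k 3≤k p q kp<a
  open Union k 3≤k p q positions monochromatic sparse
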